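{- For every integer $s\ge 4$ and every positive integer $r$, $$R^{\mathrm{KG}}_r(s-1,s)\le r\,R(s-2,s)+2\bigl(R(s-2,s-1)-1\bigr)+2r.$$
   Context: $R(a,b)$ is the classical Ramsey number: the least $n$ such that every red/blue edge-coloring of $K_n$ contains a red $K_a$ or a blue $K_b$. The Kneser graph $\mathrm{KG}(n,r)$ has vertex set the $r$-element subsets of $[n]=\{1,\dots,n\}$, with two sets adjacent iff they are disjoint. The $r$-Kneser Ramsey number $R^{\mathrm{KG}}_r(a,b)$ is the minimum integer $n$ such that every red/blue edge-coloring of $\mathrm{KG}(n,r)$ contains a red $K_a$ (a set of $a$ pairwise adjacent vertices with all connecting edges red) or a blue $K_b$. -}

module Defs where

open import Data.Nat using (ℕ; _≤_; _<_)
open import Data.Bool using (Bool; true; false)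
open import Data.Fin using (Fin)
open import Data.Fin.Subset using (Subset; ∣_∣; _∩_; Empty)
open import Data.Product using (Σ; _×_)
open import Relation.Binary.PropositionalEquality using (_≡_; _≢_)

-- A red/blue edge-colouring of a graph with vertex type V and adjacency Adj:
-- a symmetric map V → V → Bool (true = red, false = blue); only its values
-- on adjacent pairs matter.
record Colouring (V : Set) : Set where
  field
    col : V → V → Bool
    sym : ∀ u v → col u v ≡ col v u
open Colouring public

MonoClique : {V : Set} → (V → V → Set) → Colouring V → Bool → ℕ → Set
MonoClique {V} Adj c b a =
  Σ (Fin a → V) λ f → ∀ i j → i ≢ j → Adj (f i) (f j) × col c (f i) (f j) ≡ b

RamseyProp : (V : Set) → (V → V → Set) → ℕ → ℕ → Set
RamseyProp V Adj a b =
  (c : Colouring V) → MonoClique Adj c true a ⊎' MonoClique Adj c false b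
  where
  open import Data.Sum using () renaming (_⊎_ to _⊎'_)

KAdj : (n : ℕ) → Fin n → Fin n → Set
KAdj n u v = u ≢ v

KGVertex : ℕ → ℕ → Set
KGVertex n r = Σ (Subset n) λ S → ∣ S ∣ ≡ r

KGAdj : (n r : ℕ) → KGVertex n r → KGVertex n r → Set
KGAdj n r (S Data.Product., _) (T Data.Product., _) = Empty (S ∩ T)

IsLeast : (ℕ → Set) → ℕ → Set
IsLeast P m = P m × (∀ k → k < m → P k → Data.Empty.⊥)
  where import Data.Empty

IsRamseyNumber : ℕ → ℕ → ℕ → Set
IsRamseyNumber a b = IsLeast (λ n → RamseyProp (Fin n) (KAdj n) a b)

IsKneserRamseyNumber : ℕ → ℕ → ℕ → ℕ → Set
IsKneserRamseyNumber r a b =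
  IsLeast (λ n → RamseyProp (KGVertex n r) (KGAdj n r) a b)

{-# OPTIONS --safe #-}
-- Let a = R(s-2,s), m = R(s-2,s-1), and fix disjoint vertices A, B of the Kneser graph joined by
-- a blue edge (if A has no blue neighbour, every vertex disjoint from it is a red neighbour).
-- Three-colour the r-sets X disjoint from A and B: AX red; AX blue and BX red; AX and BX blue.
-- Then a disjoint sets of the first colour, or m of the second, or m of the third, contain with
-- A, B a red K_{s-1} or a blue K_s; for the third colour this uses R(s-1,s-2) = R(s-2,s-1).
-- That such sets exist among r a + 2 (m - 1) points follows from the Alon-Frankl-Lovász theorem:
-- if the r-sets of at least r k + t (k - 1) points are coloured with t + 1 colours, then some
-- colour contains k pairwise disjoint sets.  It is multiplicative in k, and for prime k it is
-- deduced from a ℤ/p-Tucker lemma, proved by evaluating powers of the generator of H²(ℤ/p) on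
-- explicit chains of sign vectors.  Starting from k = m, one passes from m to a sets of the first
-- colour by removing sets of that colour one at a time, as m ≤ a.
module Submission where

open import Defs hiding (sym)
open import Data.Nat as ℕ using (ℕ; zero; suc; z≤n; s≤s; _+_; _*_; _∸_; _^_; _≤_; _<_)
open import Data.Product using (Σ; _×_; _,_; proj₁; proj₂; ∃)
open import Algebra.Properties.AbelianGroup using (∙-cancelʳ)
open import Data.Bool using (Bool; true; false; if_then_else_; not)
import Data.Bool.Properties as Boolₚ
open import Data.Empty using (⊥; ⊥-elim)
open import Data.Fin using (Fin; zero; suc; toℕ; fromℕ<; remQuot; combine; finToFun; funToFin)
import Data.Fin.Properties as Finₚ
open import Data.Fin.Subset using (Subset; inside; outside; _∈_; _⊆_; _∩_; _─_; Empty) renaming (⊤ to Full; ⊥ to None; ∣_∣ to card)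
import Data.Fin.Subset.Properties as Subsetₚ
open import Data.Integer using (ℤ; 0ℤ; 1ℤ; ∣_∣) renaming (+_ to pos; _+_ to _+ᶻ_; _-_ to _-ᶻ_; _*_ to _*ᶻ_; -_ to neg)
open import Data.Integer.DivMod using (_/ℕ_; n%ℕd<d; a≡a%ℕn+[a/ℕn]*n)
import Data.Integer.Properties as ℤₚ
open import Data.Integer.Tactic.RingSolver using (solve-∀)
open import Data.Maybe as Maybe using (Maybe; just; nothing)
open import Data.Nat.Coprimality using (coprime?; coprime-Bézout; prime⇒coprime)
open import Data.Nat.Divisibility using (divides; ∣⇒≤)
open import Data.Nat.DivMod using (_%_; _mod_; m%n%n≡m%n; %-distribˡ-+; [m+n]%n≡m%n; m<n⇒m%n≡m; n%n≡0; m%n<n)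
open import Data.Nat.GCD using (module Bézout)
open import Data.Nat.Induction using (<-rec)
open import Data.Nat.Primality using (Prime; prime; composite?; composite; prime⇒nonTrivial)
import Data.Nat.Properties as ℕₚ
open import Data.Nat.Tactic.RingSolver using () renaming (solve-∀ to ℕ-solve-∀)
open import Data.Sum as Sum using (_⊎_; inj₁; inj₂)
open import Data.Unit using (⊤; tt)
open import Data.Vec using (Vec; []; _∷_; map; replicate; tabulate; lookup; here; there)
import Data.Vec.Properties as Vecₚ
open import Data.Vec.Relation.Binary.Pointwise.Inductive as Pw using (Pointwise; []; _∷_)
open import Function using (_∘_; id)
open import Relation.Binary.PropositionalEquality
open import Relation.Nullary using (Dec; does; yes; no; ¬_; contradiction)
open import Relation.Nullary.Decidable using (dec-true; dec-false; map′; _×-dec_; _→-dec_; _⊎-dec_; ¬?)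

-- Cochains on tuples and the cone homotopy

Cochain : Set → ℕ → Set
Cochain A k = Vec A k → ℤ

coboundary : ∀ {A k} → Cochain A k → Cochain A (suc k)
coboundary {k = zero} F (x ∷ []) = F []
coboundary {k = suc k} F (x ∷ xs) = F xs -ᶻ coboundary (λ l → F (x ∷ l)) xs

coboundary-cong : ∀ {A k} {F G : Cochain A k} → (∀ l → F l ≡ G l) →
  ∀ xs → coboundary F xs ≡ coboundary G xs
coboundary-cong {k = zero} e (x ∷ []) = e []
coboundary-cong {k = suc k} e (x ∷ xs) =
  cong₂ _-ᶻ_ (e xs) (coboundary-cong (λ l → e (x ∷ l)) xs)

coboundary-0 : ∀ {A k} (xs : Vec A (suc k)) → coboundary (λ _ → 0ℤ) xs ≡ 0ℤ
coboundary-0 {k = zero} (x ∷ []) = refl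
coboundary-0 {k = suc k} (x ∷ xs) = cong (0ℤ -ᶻ_) (coboundary-0 xs)

coboundary-minus : ∀ {A k} (F G : Cochain A k) xs →
  coboundary (λ l → F l -ᶻ G l) xs ≡ coboundary F xs -ᶻ coboundary G xs
coboundary-minus {k = zero} F G (x ∷ []) = refl
coboundary-minus {k = suc k} F G (x ∷ xs)
  rewrite coboundary-minus (λ l → F (x ∷ l)) (λ l → G (x ∷ l)) xs =
    ring (F xs) (G xs) (coboundary (λ l → F (x ∷ l)) xs) (coboundary (λ l → G (x ∷ l)) xs)
  where
  ring : ∀ a b c d → (a -ᶻ b) -ᶻ (c -ᶻ d) ≡ (a -ᶻ c) -ᶻ (b -ᶻ d)
  ring = solve-∀

coboundary-* : ∀ {A k} c (F : Cochain A k) xs →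
  coboundary (λ l → c *ᶻ F l) xs ≡ c *ᶻ coboundary F xs
coboundary-* {k = zero} c F (x ∷ []) = refl
coboundary-* {k = suc k} c F (x ∷ xs)
  rewrite coboundary-* c (λ l → F (x ∷ l)) xs =
    ring c (F xs) (coboundary (λ l → F (x ∷ l)) xs)
  where
  ring : ∀ c a b → c *ᶻ a -ᶻ c *ᶻ b ≡ c *ᶻ (a -ᶻ b)
  ring = solve-∀

coboundary-+ : ∀ {A k} (F G : Cochain A k) xs →
  coboundary (λ l → F l +ᶻ G l) xs ≡ coboundary F xs +ᶻ coboundary G xs
coboundary-+ {k = zero} F G (x ∷ []) = refl
coboundary-+ {k = suc k} F G (x ∷ xs)
  rewrite coboundary-+ (λ l → F (x ∷ l)) (λ l → G (x ∷ l)) xs =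
    ring (F xs) (G xs) (coboundary (λ l → F (x ∷ l)) xs) (coboundary (λ l → G (x ∷ l)) xs)
  where
  ring : ∀ a b c d → (a +ᶻ b) -ᶻ (c +ᶻ d) ≡ (a -ᶻ c) +ᶻ (b -ᶻ d)
  ring = solve-∀

coboundary-map : ∀ {A B k} (g : A → B) (F : Cochain B k) xs →
  coboundary (λ l → F (map g l)) xs ≡ coboundary F (map g xs)
coboundary-map {k = zero} g F (x ∷ []) = refl
coboundary-map {k = suc k} g F (x ∷ xs) =
  cong (F (map g xs) -ᶻ_) (coboundary-map g (λ l → F (g x ∷ l)) xs)

module _ {A B : Set} (ι τ : B → A) where

  -- The chain homotopy between ι and τ for order-preserving ι ≤ τ: it sums
  -- ±(ι x₀, …, ι xᵢ, τ xᵢ, …, τ xₖ).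
  prism : ∀ {k} → Cochain A (suc k) → Cochain B k
  prism F [] = 0ℤ
  prism F (x ∷ xs) = F (ι x ∷ τ x ∷ map τ xs) -ᶻ prism (λ l → F (ι x ∷ l)) xs

  prism-cong : ∀ {k} {F G : Cochain A (suc k)} → (∀ l → F l ≡ G l) →
    ∀ xs → prism F xs ≡ prism G xs
  prism-cong e [] = refl
  prism-cong e (x ∷ xs) = cong₂ _-ᶻ_ (e _) (prism-cong (λ l → e (ι x ∷ l)) xs)

  prism-minus : ∀ {k} (F G : Cochain A (suc k)) xs →
    prism (λ l → F l -ᶻ G l) xs ≡ prism F xs -ᶻ prism G xs
  prism-minus F G [] = refl
  prism-minus F G (x ∷ xs)
    rewrite prism-minus (λ l → F (ι x ∷ l)) (λ l → G (ι x ∷ l)) xs =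
    ring (F (ι x ∷ τ x ∷ map τ xs)) (G (ι x ∷ τ x ∷ map τ xs))
      (prism (λ l → F (ι x ∷ l)) xs) (prism (λ l → G (ι x ∷ l)) xs)
    where
    ring : ∀ a b c d → (a -ᶻ b) -ᶻ (c -ᶻ d) ≡ (a -ᶻ c) -ᶻ (b -ᶻ d)
    ring = solve-∀

  prism-homotopy : ∀ {k} (F : Cochain A (suc k)) xs →
    prism (coboundary F) xs ≡
      F (map τ xs) -ᶻ F (map ι xs) -ᶻ coboundary (prism F) xs
  prism-homotopy {zero} F (x ∷ []) = refl
  prism-homotopy {suc k} F (x ∷ ys) = begin
    (F (τ x ∷ map τ ys) -ᶻ coboundary Fx (τ x ∷ map τ ys))
      -ᶻ prism (λ l → F l -ᶻ coboundary Fx l) ys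
      ≡⟨ cong (λ z → (F (τ x ∷ map τ ys) -ᶻ coboundary Fx (τ x ∷ map τ ys)) -ᶻ z)
          (trans (prism-minus F (coboundary Fx) ys) (cong (prism F ys -ᶻ_) (prism-homotopy Fx ys))) ⟩
    (F (τ x ∷ map τ ys) -ᶻ (Fx (map τ ys) -ᶻ coboundary Fxx (map τ ys)))
      -ᶻ (prism F ys -ᶻ (Fx (map τ ys) -ᶻ Fx (map ι ys) -ᶻ coboundary (prism Fx) ys))
      ≡⟨ ring (F (τ x ∷ map τ ys)) (Fx (map τ ys)) (coboundary Fxx (map τ ys))
              (prism F ys) (Fx (map ι ys)) (coboundary (prism Fx) ys) ⟩
    F (τ x ∷ map τ ys) -ᶻ Fx (map ι ys)
      -ᶻ (prism F ys -ᶻ (coboundary Fxx (map τ ys) -ᶻ coboundary (prism Fx) ys))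
      ≡⟨ cong (λ z → F (τ x ∷ map τ ys) -ᶻ Fx (map ι ys) -ᶻ (prism F ys -ᶻ z)) (sym lem) ⟩
    F (τ x ∷ map τ ys) -ᶻ Fx (map ι ys)
      -ᶻ (prism F ys -ᶻ coboundary (λ l → prism F (x ∷ l)) ys) ∎
    where
    open ≡-Reasoning
    Fx = λ l → F (ι x ∷ l)
    Fxx = λ l → Fx (τ x ∷ l)
    lem : coboundary (λ l → prism F (x ∷ l)) ys ≡ coboundary Fxx (map τ ys) -ᶻ coboundary (prism Fx) ys
    lem = trans (coboundary-minus (λ l → Fxx (map τ l)) (prism Fx) ys)
            (cong (_-ᶻ coboundary (prism Fx) ys) (coboundary-map τ Fxx ys))
    ring : ∀ a b c d e f →
      (a -ᶻ (b -ᶻ c)) -ᶻ (d -ᶻ (b -ᶻ e -ᶻ f)) ≡ a -ᶻ e -ᶻ (d -ᶻ (c -ᶻ f))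
    ring = solve-∀

  module _ (v : A) where

    cone : ∀ {k} → Cochain A (suc k) → Cochain B k
    cone F xs = F (v ∷ map τ xs) -ᶻ prism F xs

    cone-homotopy₀ : (F : Cochain A zero) (xs : Vec B zero) →
      cone (coboundary F) xs ≡ F (map ι xs)
    cone-homotopy₀ F [] = ℤₚ.+-identityʳ (F [])

    cone-homotopy : ∀ {k} (F : Cochain A (suc k)) xs →
      cone (coboundary F) xs ≡ F (map ι xs) -ᶻ coboundary (cone F) xs
    cone-homotopy F xs
      rewrite prism-homotopy F xs
            | coboundary-minus (λ l → F (v ∷ map τ l)) (prism F) xs
            | coboundary-map τ (λ l → F (v ∷ l)) xs =
      ring (F (map τ xs)) (coboundary (λ l → F (v ∷ l)) (map τ xs))
        (F (map ι xs)) (coboundary (prism F) xs)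
      where
      ring : ∀ a b c d → (a -ᶻ b) -ᶻ (a -ᶻ c -ᶻ d) ≡ c -ᶻ (b -ᶻ d)
      ring = solve-∀

Norm : {A : Set} → (A → A) → ℕ → ∀ {k} → Cochain A k → Cochain A k
Norm g zero F xs = 0ℤ
Norm g (suc j) F xs = F xs +ᶻ Norm g j F (map g xs)

δ : {A : Set} → (A → A) → ∀ {k} → Cochain A k → Cochain A k
δ g F xs = F (map g xs) -ᶻ F xs

coboundary-δ : ∀ {A : Set} (g : A → A) {k} (F : Cochain A k) xs →
  coboundary (δ g F) xs ≡ δ g (coboundary F) xs
coboundary-δ g F xs = trans (coboundary-minus (λ l → F (map g l)) F xs)
  (cong (_-ᶻ coboundary F xs) (coboundary-map g F xs))

coboundary-Norm : ∀ {A : Set} (g : A → A) j {k} (F : Cochain A k) xs →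
  coboundary (Norm g j F) xs ≡ Norm g j (coboundary F) xs
coboundary-Norm g zero F xs = coboundary-0 xs
coboundary-Norm g (suc j) F xs = trans (coboundary-+ F (λ l → Norm g j F (map g l)) xs)
  (cong (coboundary F xs +ᶻ_)
    (trans (coboundary-map g (Norm g j F) xs) (coboundary-Norm g j F (map g xs))))

iter : {A : Set} → (A → A) → ℕ → A → A
iter g zero x = x
iter g (suc j) x = iter g j (g x)

map-iter : ∀ {A : Set} (g : A → A) j {k} (xs : Vec A k) → iter (map g) j xs ≡ map (iter g j) xs
map-iter g zero xs = sym (Vecₚ.map-id xs)
map-iter g (suc j) xs = trans (map-iter g j (map g xs)) (sym (Vecₚ.map-∘ (iter g j) g xs))

Norm-δ : ∀ {A : Set} (g : A → A) j {k} (F : Cochain A k) xs →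
  Norm g j (δ g F) xs ≡ F (iter (map g) j xs) -ᶻ F xs
Norm-δ g zero F xs = sym (ℤₚ.+-inverseʳ (F xs))
Norm-δ g (suc j) F xs rewrite Norm-δ g j F (map g xs) =
    ring (F (map g xs)) (F xs) (F (iter (map g) j (map g xs)))
  where
  ring : ∀ a b c → (a -ᶻ b) +ᶻ (c -ᶻ a) ≡ c -ᶻ b
  ring = solve-∀

δ-Norm : ∀ {A : Set} (g : A → A) j {k} (F : Cochain A k) xs →
  δ g (Norm g j F) xs ≡ Norm g j (δ g F) xs
δ-Norm g zero F xs = refl
δ-Norm g (suc j) F xs =
  trans (ring (F (map g xs)) (Norm g j F (map g (map g xs))) (F xs) (Norm g j F (map g xs)))
    (cong (δ g F xs +ᶻ_) (δ-Norm g j F (map g xs)))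
  where
  ring : ∀ a b c d → (a +ᶻ b) -ᶻ (c +ᶻ d) ≡ (a -ᶻ c) +ᶻ (b -ᶻ d)
  ring = solve-∀

module Congruence (p : ℕ) where

  infix 4 _≈_
  record _≈_ (a b : ℤ) : Set where
    constructor mod
    field
      quot : ℤ
      equation : a ≡ b +ᶻ quot *ᶻ pos p

  ≡⇒≈ : ∀ {a b} → a ≡ b → a ≈ b
  ≡⇒≈ {a} {b} refl = mod 0ℤ (sym (ℤₚ.+-identityʳ b))

  ≈-trans : ∀ {a b c} → a ≈ b → b ≈ c → a ≈ c
  ≈-trans {c = c} (mod k refl) (mod l refl) = mod (l +ᶻ k) (ring c k l (pos p))
    where
    ring : ∀ c k l q → c +ᶻ l *ᶻ q +ᶻ k *ᶻ q ≡ c +ᶻ (l +ᶻ k) *ᶻ q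
    ring = solve-∀

  ≈-sym : ∀ {a b} → a ≈ b → b ≈ a
  ≈-sym {b = b} (mod k refl) = mod (0ℤ -ᶻ k) (ring b k (pos p))
    where
    ring : ∀ c k q → c ≡ c +ᶻ k *ᶻ q +ᶻ (0ℤ -ᶻ k) *ᶻ q
    ring = solve-∀

  +-cong : ∀ {a b c d} → a ≈ b → c ≈ d → a +ᶻ c ≈ b +ᶻ d
  +-cong {b = b} {d = d} (mod k refl) (mod l refl) = mod (k +ᶻ l) (ring b d k l (pos p))
    where
    ring : ∀ b d k l q → b +ᶻ k *ᶻ q +ᶻ (d +ᶻ l *ᶻ q) ≡ b +ᶻ d +ᶻ (k +ᶻ l) *ᶻ q
    ring = solve-∀

  minus-cong : ∀ {a b c d} → a ≈ b → c ≈ d → a -ᶻ c ≈ b -ᶻ d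
  minus-cong {b = b} {d = d} (mod k refl) (mod l refl) = mod (k -ᶻ l) (ring b d k l (pos p))
    where
    ring : ∀ b d k l q → b +ᶻ k *ᶻ q -ᶻ (d +ᶻ l *ᶻ q) ≡ b -ᶻ d +ᶻ (k -ᶻ l) *ᶻ q
    ring = solve-∀

  *-congʳ : ∀ {a b} c → a ≈ b → a *ᶻ c ≈ b *ᶻ c
  *-congʳ {b = b} c (mod k refl) = mod (k *ᶻ c) (ring b c k (pos p))
    where
    ring : ∀ b c k q → (b +ᶻ k *ᶻ q) *ᶻ c ≡ b *ᶻ c +ᶻ k *ᶻ c *ᶻ q
    ring = solve-∀

module SignVectors {G : Set} where

  SignVector : ℕ → Set
  SignVector n = Vec (Maybe G) n

  𝟎 : ∀ {n} → SignVector n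
  𝟎 = replicate _ nothing

  data _≼_ : Maybe G → Maybe G → Set where
    none : ∀ {y} → nothing ≼ y
    same : ∀ {a} → just a ≼ just a

  ≼-refl : ∀ {y} → y ≼ y
  ≼-refl {nothing} = none
  ≼-refl {just _} = same

  weight : ∀ {n} → SignVector n → ℕ
  weight [] = 0
  weight (nothing ∷ x) = weight x
  weight (just _ ∷ x) = suc (weight x)

  infix 4 _⊏_
  _⊏_ : ∀ {n} → SignVector n → SignVector n → Set
  x ⊏ y = Pointwise _≼_ x y × weight x < weight y

  Chain : ∀ {n k} → SignVector n → Vec (SignVector n) k → Set
  Chain y [] = ⊤
  Chain y (x ∷ xs) = y ⊏ x × Chain x xs

  Chain-map : ∀ {n m k} (g : SignVector n → SignVector m) →
    (∀ {x y} → x ⊏ y → g x ⊏ g y) → ∀ {y} (xs : Vec (SignVector n) k) →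
    Chain y xs → Chain (g y) (map g xs)
  Chain-map g mono [] _ = tt
  Chain-map g mono (x ∷ xs) (p , c) = mono p , Chain-map g mono xs c

module Functional (p' : ℕ) {G : Set} (rot : G → G) (o : G)
                  (rot-order : ∀ a → iter rot (suc p') a ≡ a) where

  open Congruence (suc p') public
  open SignVectors {G} public

  rotate : ∀ {n} → SignVector n → SignVector n
  rotate = map (Maybe.map rot)

  ι τ : ∀ {n} → SignVector n → SignVector (suc n)
  ι = nothing ∷_
  τ = just o ∷_

  rotate-𝟎 : ∀ n → rotate (𝟎 {n}) ≡ 𝟎
  rotate-𝟎 n = Vecₚ.map-replicate _ nothing n

  weight-rotate : ∀ {n} (x : SignVector n) → weight (rotate x) ≡ weight x
  weight-rotate [] = refl
  weight-rotate (nothing ∷ x) = weight-rotate x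
  weight-rotate (just _ ∷ x) = cong suc (weight-rotate x)

  ≼-rot : ∀ {a b} → a ≼ b → Maybe.map rot a ≼ Maybe.map rot b
  ≼-rot none = none
  ≼-rot same = same

  rotate-⊏ : ∀ {n} {x y : SignVector n} → x ⊏ y → rotate x ⊏ rotate y
  rotate-⊏ {x = x} {y} (p , q) =
    Pw.map⁺ ≼-rot p , subst₂ _<_ (sym (weight-rotate x)) (sym (weight-rotate y)) q

  rotate-Chain : ∀ {n k} (xs : Vec (SignVector n) k) → Chain 𝟎 xs → Chain 𝟎 (map rotate xs)
  rotate-Chain {n} xs c =
    subst (λ z → Chain z (map rotate xs)) (rotate-𝟎 n) (Chain-map rotate rotate-⊏ xs c)

  iter-nothing : ∀ j → iter (Maybe.map rot) j nothing ≡ nothing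
  iter-nothing zero = refl
  iter-nothing (suc j) = iter-nothing j

  iter-just : ∀ j a → iter (Maybe.map rot) j (just a) ≡ just (iter rot j a)
  iter-just zero a = refl
  iter-just (suc j) a = iter-just j (rot a)

  rotate-order : ∀ {n} (x : SignVector n) → iter rotate (suc p') x ≡ x
  rotate-order x = trans (map-iter (Maybe.map rot) (suc p') x)
    (trans (Vecₚ.map-cong step x) (Vecₚ.map-id x))
    where
    step : ∀ y → iter (Maybe.map rot) (suc p') y ≡ y
    step nothing = iter-nothing (suc p')
    step (just a) = trans (iter-just (suc p') a) (cong just (rot-order a))

  map-rotate-order : ∀ {n k} (xs : Vec (SignVector n) k) → iter (map rotate) (suc p') xs ≡ xs
  map-rotate-order xs = trans (map-iter rotate (suc p') xs)
    (trans (Vecₚ.map-cong rotate-order xs) (Vecₚ.map-id xs))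

  ν : ∀ {n} → ℕ → ∀ {k} → Cochain (SignVector n) k → Cochain (SignVector n) k
  ν zero F = F
  ν (suc zero) F = δ rotate F
  ν (suc (suc zero)) F = Norm rotate (suc p') F
  ν (suc (suc (suc m))) F = ν (suc m) F

  fill : ∀ {n k} → Cochain (SignVector (suc n)) (suc k) → Cochain (SignVector n) k
  fill = cone ι τ (τ 𝟎)

  -- Evaluation on a chain cₙ, where c₀ is the empty simplex and cₙ₊₁ fills the cycle νₙ cₙ; the
  -- operators νₙ = 1, g - 1, N, g - 1, N, … are those of the periodic resolution of ℤ/p.
  I : ∀ n → Cochain (SignVector n) n → ℤ
  I zero F = F []
  I (suc n) F = I n (ν n (fill F))

  OnChains : ∀ {n k} → (ℤ → ℤ → Set) → Cochain (SignVector n) k → Cochain (SignVector n) k → Set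
  OnChains _~_ F G = ∀ xs → Chain 𝟎 xs → F xs ~ G xs

  Norm-cong : ∀ {n k} j {F G : Cochain (SignVector n) k} → OnChains _≈_ F G →
    OnChains _≈_ (Norm rotate j F) (Norm rotate j G)
  Norm-cong zero e xs c = ≡⇒≈ refl
  Norm-cong (suc j) e xs c = +-cong (e xs c) (Norm-cong j e (map rotate xs) (rotate-Chain xs c))

  ν-cong : ∀ {n k} m {F G : Cochain (SignVector n) k} → OnChains _≈_ F G →
    OnChains _≈_ (ν m F) (ν m G)
  ν-cong zero e = e
  ν-cong (suc zero) e xs c = minus-cong (e _ (rotate-Chain xs c)) (e xs c)
  ν-cong (suc (suc zero)) e = Norm-cong (suc p') e
  ν-cong (suc (suc (suc m))) e = ν-cong (suc m) e

  ι-⊏ : ∀ {n} {x y : SignVector n} → x ⊏ y → ι x ⊏ ι y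
  ι-⊏ (p , q) = none ∷ p , q

  τ-⊏ : ∀ {n} {x y : SignVector n} → x ⊏ y → τ x ⊏ τ y
  τ-⊏ (p , q) = same ∷ p , ℕ.s≤s q

  ι⊏τ : ∀ {n} (x : SignVector n) → ι x ⊏ τ x
  ι⊏τ x = none ∷ Pw.refl ≼-refl , ℕₚ.n<1+n _

  prism-≈ : ∀ {n k} (y : SignVector n) {F G : Cochain (SignVector (suc n)) (suc k)} →
    (∀ zs → Chain (ι y) zs → F zs ≈ G zs) →
    ∀ xs → Chain y xs → prism ι τ F xs ≈ prism ι τ G xs
  prism-≈ y e [] c = ≡⇒≈ refl
  prism-≈ y e (x ∷ xs) (y⊏x , c) =
    minus-cong (e _ (ι-⊏ y⊏x , ι⊏τ x , Chain-map τ τ-⊏ xs c))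
           (prism-≈ x (λ zs c' → e _ (ι-⊏ y⊏x , c')) xs c)

  fill-cong : ∀ {n k} {F G : Cochain (SignVector (suc n)) (suc k)} → OnChains _≈_ F G →
    OnChains _≈_ (fill F) (fill G)
  fill-cong e xs c = minus-cong (e _ (ι⊏τ 𝟎 , Chain-map τ τ-⊏ xs c)) (prism-≈ 𝟎 e xs c)

  I-cong : ∀ n {F G : Cochain (SignVector n) n} → OnChains _≈_ F G → I n F ≈ I n G
  I-cong zero e = e [] tt
  I-cong (suc n) e = I-cong n (ν-cong n (fill-cong e))

  Norm-minus : ∀ {A : Set} (g : A → A) j {k} (F G : Cochain A k) xs →
    Norm g j (λ l → F l -ᶻ G l) xs ≡ Norm g j F xs -ᶻ Norm g j G xs
  Norm-minus g zero F G xs = refl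
  Norm-minus g (suc j) F G xs rewrite Norm-minus g j F G (map g xs) =
    ring (F xs) (G xs) (Norm g j F (map g xs)) (Norm g j G (map g xs))
    where
    ring : ∀ a b c d → (a -ᶻ b) +ᶻ (c -ᶻ d) ≡ (a +ᶻ c) -ᶻ (b +ᶻ d)
    ring = solve-∀

  ν-minus : ∀ {n} m {k} (F G : Cochain (SignVector n) k) xs →
    ν m (λ l → F l -ᶻ G l) xs ≡ ν m F xs -ᶻ ν m G xs
  ν-minus zero F G xs = refl
  ν-minus (suc zero) F G xs = ring (F (map rotate xs)) (G (map rotate xs)) (F xs) (G xs)
    where
    ring : ∀ a b c d → (a -ᶻ b) -ᶻ (c -ᶻ d) ≡ (a -ᶻ c) -ᶻ (b -ᶻ d)
    ring = solve-∀
  ν-minus (suc (suc zero)) F G xs = Norm-minus rotate (suc p') F G xs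
  ν-minus (suc (suc (suc m))) F G xs = ν-minus (suc m) F G xs

  fill-minus : ∀ {n k} (F G : Cochain (SignVector (suc n)) (suc k)) xs →
    fill (λ l → F l -ᶻ G l) xs ≡ fill F xs -ᶻ fill G xs
  fill-minus F G xs rewrite prism-minus ι τ F G xs =
    ring (F (τ 𝟎 ∷ map τ xs)) (G (τ 𝟎 ∷ map τ xs)) (prism ι τ F xs) (prism ι τ G xs)
    where
    ring : ∀ a b c d → (a -ᶻ b) -ᶻ (c -ᶻ d) ≡ (a -ᶻ c) -ᶻ (b -ᶻ d)
    ring = solve-∀

  I-minus : ∀ n (F G : Cochain (SignVector n) n) → I n (λ l → F l -ᶻ G l) ≈ I n F -ᶻ I n G
  I-minus zero F G = ≡⇒≈ refl
  I-minus (suc n) F G = ≈-trans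
    (I-cong n (λ xs c → ≈-trans (ν-cong n (λ ys _ → ≡⇒≈ (fill-minus F G ys)) xs c)
                                (≡⇒≈ (ν-minus n (fill F) (fill G) xs))))
    (I-minus n (ν n (fill F)) (ν n (fill G)))

  I-0 : ∀ n → I n (λ _ → 0ℤ) ≈ 0ℤ
  I-0 n = ≈-trans (I-minus n (λ _ → 0ℤ) (λ _ → 0ℤ)) (≡⇒≈ (ℤₚ.+-inverseʳ (I n (λ _ → 0ℤ))))

  ν-coboundary : ∀ {n} m {k} (F : Cochain (SignVector n) k) xs →
    coboundary (ν m F) xs ≡ ν m (coboundary F) xs
  ν-coboundary zero F xs = refl
  ν-coboundary (suc zero) F xs = coboundary-δ rotate F xs
  ν-coboundary (suc (suc zero)) F xs = coboundary-Norm rotate (suc p') F xs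
  ν-coboundary (suc (suc (suc m))) F xs = ν-coboundary (suc m) F xs

  map-rotate-ι : ∀ {n k} (xs : Vec (SignVector n) k) → map rotate (map ι xs) ≡ map ι (map rotate xs)
  map-rotate-ι xs = trans (sym (Vecₚ.map-∘ rotate ι xs)) (Vecₚ.map-∘ ι rotate xs)

  Norm-ι : ∀ {n} j {k} (F : Cochain (SignVector (suc n)) k) xs →
    Norm rotate j F (map ι xs) ≡ Norm rotate j (F ∘ map ι) xs
  Norm-ι zero F xs = refl
  Norm-ι (suc j) F xs = cong (F (map ι xs) +ᶻ_)
    (trans (cong (Norm rotate j F) (map-rotate-ι xs)) (Norm-ι j F (map rotate xs)))

  ν-ι : ∀ {n} m {k} (F : Cochain (SignVector (suc n)) k) xs →
    ν m F (map ι xs) ≡ ν m (F ∘ map ι) xs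
  ν-ι zero F xs = refl
  ν-ι (suc zero) F xs = cong (λ l → F l -ᶻ F (map ι xs)) (map-rotate-ι xs)
  ν-ι (suc (suc zero)) F xs = Norm-ι (suc p') F xs
  ν-ι (suc (suc (suc m))) F xs = ν-ι (suc m) F xs

  Norm-δ-0 : ∀ {n k} (F : Cochain (SignVector n) k) xs → Norm rotate (suc p') (δ rotate F) xs ≡ 0ℤ
  Norm-δ-0 F xs = trans (Norm-δ rotate (suc p') F xs)
    (trans (cong (λ l → F l -ᶻ F xs) (map-rotate-order xs)) (ℤₚ.+-inverseʳ (F xs)))

  νν-0 : ∀ n (F : Cochain (SignVector n) n) xs → ν n (ν (suc n) F) xs ≡ 0ℤ
  νν-0 zero F [] = ℤₚ.+-inverseʳ (F [])
  νν-0 (suc n) F xs = go n F xs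
    where
    go : ∀ {n k} m (F : Cochain (SignVector n) k) xs → ν (suc m) (ν (suc (suc m)) F) xs ≡ 0ℤ
    go zero F xs = trans (δ-Norm rotate (suc p') F xs) (Norm-δ-0 F xs)
    go (suc zero) F xs = Norm-δ-0 F xs
    go (suc (suc m)) F xs = go m F xs

  Stokes : ∀ n (F : Cochain (SignVector (suc n)) n) →
    I (suc n) (coboundary F) ≈ I n (ν n (F ∘ map ι))
  Stokes zero F = ≡⇒≈ (cone-homotopy₀ ι τ (τ 𝟎) F [])
  Stokes (suc n) F = ≈-trans
    (I-cong (suc n) (λ xs c → ≈-trans
      (ν-cong (suc n) (λ ys _ → ≡⇒≈ (cone-homotopy ι τ (τ 𝟎) F ys)) xs c)
      (≡⇒≈ (ν-minus (suc n) (F ∘ map ι) (coboundary (fill F)) xs))))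
    (≈-trans (I-minus (suc n) (ν (suc n) (F ∘ map ι)) (ν (suc n) (coboundary (fill F))))
      (≈-trans (minus-cong {a = I (suc n) (ν (suc n) (F ∘ map ι))} (≡⇒≈ refl) exact)
        (≡⇒≈ (ℤₚ.+-identityʳ (I (suc n) (ν (suc n) (F ∘ map ι)))))))
    where
    exact : I (suc n) (ν (suc n) (coboundary (fill F))) ≈ 0ℤ
    exact = ≈-trans
      (I-cong (suc n) {G = coboundary (ν (suc n) (fill F))}
        (λ xs _ → ≡⇒≈ (sym (ν-coboundary (suc n) (fill F) xs))))
      (≈-trans (Stokes n (ν (suc n) (fill F)))
        (≈-trans
          (I-cong n (λ xs c → ≈-trans
            (ν-cong n (λ ys _ → ≡⇒≈ (ν-ι (suc n) (fill F) ys)) xs c)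
            (≡⇒≈ (νν-0 n (fill F ∘ map ι) xs))))
          (I-0 n)))

-- The ℤ/p-Tucker lemma

data Repeat {A : Set} : ∀ {k} → Vec A k → Set where
  here : ∀ {k a} {xs : Vec A k} → Repeat (a ∷ a ∷ xs)
  there : ∀ {k a} {xs : Vec A k} → Repeat xs → Repeat (a ∷ xs)

coboundary² : ∀ {A k} (F : Cochain A k) xs → coboundary (coboundary F) xs ≡ 0ℤ
coboundary² {k = zero} F (x ∷ y ∷ []) = ℤₚ.+-inverseʳ (F [])
coboundary² {k = suc k} F (x ∷ xs) = trans
  (cong (coboundary F xs -ᶻ_) (trans (coboundary-minus F (coboundary (λ l → F (x ∷ l))) xs)
    (cong (coboundary F xs -ᶻ_) (coboundary² (λ l → F (x ∷ l)) xs))))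
  (ring (coboundary F xs))
  where
  ring : ∀ a → a -ᶻ (a -ᶻ 0ℤ) ≡ 0ℤ
  ring = solve-∀

module Cyclic (p' : ℕ) where

  p : ℕ
  p = suc p'

  rot : Fin p → Fin p
  rot a = suc (toℕ a) mod p

  toℕ-rot : ∀ a → toℕ (rot a) ≡ suc (toℕ a) % p
  toℕ-rot a = Finₚ.toℕ-fromℕ< (m%n<n (suc (toℕ a)) p)

  toℕ-iter-rot : ∀ j a → toℕ (iter rot j a) ≡ (toℕ a + j) % p
  toℕ-iter-rot zero a = trans (sym (m<n⇒m%n≡m (Finₚ.toℕ<n a))) (cong (_% p) (sym (ℕₚ.+-identityʳ (toℕ a))))
  toℕ-iter-rot (suc j) a = begin
    toℕ (iter rot j (rot a))            ≡⟨ toℕ-iter-rot j (rot a) ⟩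
    (toℕ (rot a) + j) % p             ≡⟨ cong (λ z → (z + j) % p) (toℕ-rot a) ⟩
    (suc (toℕ a) % p + j) % p         ≡⟨ %-distribˡ-+ (suc (toℕ a) % p) j p ⟩
    (suc (toℕ a) % p % p + j % p) % p ≡⟨ cong (λ z → (z + j % p) % p) (m%n%n≡m%n (suc (toℕ a)) p) ⟩
    (suc (toℕ a) % p + j % p) % p     ≡⟨ %-distribˡ-+ (suc (toℕ a)) j p ⟨
    (suc (toℕ a) + j) % p             ≡⟨ cong (_% p) (sym (ℕₚ.+-suc (toℕ a) j)) ⟩
    (toℕ a + suc j) % p               ∎
    where open ≡-Reasoning

  rot-order : ∀ a → iter rot p a ≡ a
  rot-order a = Finₚ.toℕ-injective
    (trans (toℕ-iter-rot p a) (trans ([m+n]%n≡m%n (toℕ a) p) (m<n⇒m%n≡m (Finₚ.toℕ<n a))))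

  iter-rot-zero : ∀ a → iter rot (toℕ a) zero ≡ a
  iter-rot-zero a = Finₚ.toℕ-injective (trans (toℕ-iter-rot (toℕ a) zero) (m<n⇒m%n≡m (Finₚ.toℕ<n a)))

  rot-cases : ∀ a → (toℕ a ≡ p' × toℕ (rot a) ≡ 0) ⊎ (toℕ a < p' × toℕ (rot a) ≡ suc (toℕ a))
  rot-cases a with ℕₚ.m≤n⇒m<n∨m≡n (ℕₚ.≤-pred (Finₚ.toℕ<n a))
  ... | inj₁ a<p' = inj₂ (a<p' , trans (toℕ-rot a) (m<n⇒m%n≡m (s≤s a<p')))
  ... | inj₂ a≡p' = inj₁ (a≡p' , trans (toℕ-rot a) (trans (cong (λ z → suc z % p) a≡p') (n%n≡0 p)))

  open Functional p' rot zero rot-order public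

  val top : Fin p → ℤ
  val a = pos (toℕ a)
  top a = if does (toℕ a ℕ.≟ p') then 1ℤ else 0ℤ

  top≡1 : ∀ {a} → toℕ a ≡ p' → top a ≡ 1ℤ
  top≡1 {a} e = cong (if_then 1ℤ else 0ℤ) (dec-true (toℕ a ℕ.≟ p') e)

  top≡0 : ∀ {a} → toℕ a < p' → top a ≡ 0ℤ
  top≡0 {a} l = cong (if_then 1ℤ else 0ℤ) (dec-false (toℕ a ℕ.≟ p') (ℕₚ.<⇒≢ l))

  desc : Fin p → Fin p → ℤ
  desc a b = if does (toℕ b ℕ.<? toℕ a) then 1ℤ else 0ℤ

  desc≡1 : ∀ {a b} → toℕ b < toℕ a → desc a b ≡ 1ℤ
  desc≡1 {a} {b} l = cong (if_then 1ℤ else 0ℤ) (dec-true (toℕ b ℕ.<? toℕ a) l)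

  desc≡0 : ∀ {a b} → toℕ a ≤ toℕ b → desc a b ≡ 0ℤ
  desc≡0 {a} {b} l = cong (if_then 1ℤ else 0ℤ) (dec-false (toℕ b ℕ.<? toℕ a) (ℕₚ.≤⇒≯ l))

  desc-refl : ∀ a → desc a a ≡ 0ℤ
  desc-refl a = desc≡0 {a} {a} ℕₚ.≤-refl

  val-rot : ∀ a → val (rot a) ≡ val a +ᶻ 1ℤ -ᶻ pos p *ᶻ top a
  val-rot a with rot-cases a
  ... | inj₁ (e , e') = trans (cong pos e')
    (sym (trans (cong₂ (λ x y → pos x +ᶻ 1ℤ -ᶻ pos p *ᶻ y) e (top≡1 {a} e)) (ring (pos p'))))
    where
    ring : ∀ x → x +ᶻ 1ℤ -ᶻ (1ℤ +ᶻ x) *ᶻ 1ℤ ≡ 0ℤ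
    ring = solve-∀
  ... | inj₂ (l , e') = trans (cong pos e')
    (sym (trans (cong (λ y → val a +ᶻ 1ℤ -ᶻ pos p *ᶻ y) (top≡0 {a} l)) (ring (val a) (pos p))))
    where
    ring : ∀ x y → x +ᶻ 1ℤ -ᶻ y *ᶻ 0ℤ ≡ 1ℤ +ᶻ x
    ring = solve-∀

  desc-rot : ∀ a b → desc (rot a) (rot b) ≡ desc a b +ᶻ (top b -ᶻ top a)
  desc-rot a b with rot-cases a | rot-cases b
  ... | inj₁ (e , e') | inj₁ (f , f')
    rewrite desc≡0 {rot a} {rot b} (ℕₚ.≤-reflexive (trans e' (sym f')))
          | desc≡0 {a} {b} (ℕₚ.≤-reflexive (trans e (sym f))) | top≡1 {a} e | top≡1 {b} f = refl
  ... | inj₁ (e , e') | inj₂ (l , f')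
    rewrite desc≡0 {rot a} {rot b} (subst (ℕ._≤ toℕ (rot b)) (sym e') z≤n)
          | desc≡1 {a} {b} (subst (toℕ b <_) (sym e) l) | top≡1 {a} e | top≡0 {b} l = refl
  ... | inj₂ (l , e') | inj₁ (f , f')
    rewrite desc≡1 {rot a} {rot b} (subst₂ _<_ (sym f') (sym e') ℕ.z<s)
          | desc≡0 {a} {b} (subst (toℕ a ≤_) (sym f) (ℕₚ.<⇒≤ l)) | top≡0 {a} l | top≡1 {b} f = refl
  ... | inj₂ (l , e') | inj₂ (m , f') rewrite top≡0 {a} l | top≡0 {b} m with ℕₚ.<-≤-connex (toℕ b) (toℕ a)
  ...   | inj₁ b<a rewrite desc≡1 {rot a} {rot b} (subst₂ _<_ (sym f') (sym e') (s≤s b<a))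
                         | desc≡1 {a} {b} b<a = refl
  ...   | inj₂ a≤b rewrite desc≡0 {rot a} {rot b} (subst₂ _≤_ (sym e') (sym f') (s≤s a≤b))
                         | desc≡0 {a} {b} a≤b = refl

  orbitSum : ℕ → (Fin p → ℤ) → Fin p → ℤ
  orbitSum zero f a = 0ℤ
  orbitSum (suc j) f a = f a +ᶻ orbitSum j f (rot a)

  orbitSum-rot : ∀ j f a → orbitSum j f (rot a) +ᶻ f a ≡ orbitSum j f a +ᶻ f (iter rot j a)
  orbitSum-rot zero f a = refl
  orbitSum-rot (suc j) f a = begin
    f (rot a) +ᶻ orbitSum j f (rot (rot a)) +ᶻ f a
      ≡⟨ ring₁ (f (rot a)) (orbitSum j f (rot (rot a))) (f a) ⟩
    f a +ᶻ (orbitSum j f (rot (rot a)) +ᶻ f (rot a))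
      ≡⟨ cong (f a +ᶻ_) (orbitSum-rot j f (rot a)) ⟩
    f a +ᶻ (orbitSum j f (rot a) +ᶻ f (iter rot j (rot a)))
      ≡⟨ ℤₚ.+-assoc (f a) (orbitSum j f (rot a)) (f (iter rot j (rot a))) ⟨
    f a +ᶻ orbitSum j f (rot a) +ᶻ f (iter rot j (rot a)) ∎
    where
    open ≡-Reasoning
    ring₁ : ∀ x y z → x +ᶻ y +ᶻ z ≡ z +ᶻ (y +ᶻ x)
    ring₁ = solve-∀

  orbitSum-full-rot : ∀ f a → orbitSum p f (rot a) ≡ orbitSum p f a
  orbitSum-full-rot f a =
    ∙-cancelʳ ℤₚ.+-0-abelianGroup (f a) (orbitSum p f (rot a)) (orbitSum p f a)
      (trans (orbitSum-rot p f a) (cong (λ z → orbitSum p f a +ᶻ f z) (rot-order a)))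

  orbitSum-full : ∀ f a → orbitSum p f a ≡ orbitSum p f zero
  orbitSum-full f a = trans (cong (orbitSum p f) (sym (iter-rot-zero a))) (go (toℕ a) zero)
    where
    go : ∀ j b → orbitSum p f (iter rot j b) ≡ orbitSum p f b
    go zero b = refl
    go (suc j) b = trans (go j (rot b)) (orbitSum-full-rot f b)

  descents : ℕ → Fin p → Fin p → ℤ
  descents zero a b = 0ℤ
  descents (suc j) a b = desc a b +ᶻ descents j (rot a) (rot b)

  -- The residue of b - a in {0, …, p - 1}.
  dist : Fin p → Fin p → ℤ
  dist a b = val b -ᶻ val a +ᶻ pos p *ᶻ desc a b

  dist-rot : ∀ a b → dist (rot a) (rot b) ≡ dist a b
  dist-rot a b rewrite val-rot a | val-rot b | desc-rot a b =
    ring (val a) (val b) (pos p) (top a) (top b) (desc a b)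
    where
    ring : ∀ a b q s t d →
      b +ᶻ 1ℤ -ᶻ q *ᶻ t -ᶻ (a +ᶻ 1ℤ -ᶻ q *ᶻ s) +ᶻ q *ᶻ (d +ᶻ (t -ᶻ s)) ≡ b -ᶻ a +ᶻ q *ᶻ d
    ring = solve-∀

  descents-dist : ∀ j a b →
    pos p *ᶻ descents j a b ≡ pos j *ᶻ dist a b -ᶻ (orbitSum j val b -ᶻ orbitSum j val a)
  descents-dist zero a b = ℤₚ.*-zeroʳ (pos p)
  descents-dist (suc j) a b = begin
    pos p *ᶻ (desc a b +ᶻ descents j (rot a) (rot b))
      ≡⟨ ℤₚ.*-distribˡ-+ (pos p) (desc a b) (descents j (rot a) (rot b)) ⟩
    pos p *ᶻ desc a b +ᶻ pos p *ᶻ descents j (rot a) (rot b)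
      ≡⟨ cong (pos p *ᶻ desc a b +ᶻ_) (descents-dist j (rot a) (rot b)) ⟩
    pos p *ᶻ desc a b +ᶻ (pos j *ᶻ dist (rot a) (rot b) -ᶻ (S b -ᶻ S a))
      ≡⟨ cong (λ z → pos p *ᶻ desc a b +ᶻ (pos j *ᶻ z -ᶻ (S b -ᶻ S a))) (dist-rot a b) ⟩
    pos p *ᶻ desc a b +ᶻ (pos j *ᶻ dist a b -ᶻ (S b -ᶻ S a))
      ≡⟨ ring (pos p *ᶻ desc a b) (pos j) (val a) (val b) (S a) (S b) ⟩
    pos (suc j) *ᶻ dist a b -ᶻ (val b +ᶻ S b -ᶻ (val a +ᶻ S a)) ∎
    where
    open ≡-Reasoning
    S = λ c → orbitSum j val (rot c)
    ring : ∀ d j a b s t → d +ᶻ (j *ᶻ (b -ᶻ a +ᶻ d) -ᶻ (t -ᶻ s)) ≡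
      (1ℤ +ᶻ j) *ᶻ (b -ᶻ a +ᶻ d) -ᶻ (b +ᶻ t -ᶻ (a +ᶻ s))
    ring = solve-∀

  descents-full : ∀ a b → descents p a b ≡ dist a b
  descents-full a b = ℤₚ.*-cancelˡ-≡ (pos p) (descents p a b) (dist a b) (begin
    pos p *ᶻ descents p a b
      ≡⟨ descents-dist p a b ⟩
    pos p *ᶻ dist a b -ᶻ (orbitSum p val b -ᶻ orbitSum p val a)
      ≡⟨ cong (λ z → pos p *ᶻ dist a b -ᶻ (z -ᶻ orbitSum p val a))
           (trans (orbitSum-full val b) (sym (orbitSum-full val a))) ⟩
    pos p *ᶻ dist a b -ᶻ (orbitSum p val a -ᶻ orbitSum p val a)
      ≡⟨ ring (pos p *ᶻ dist a b) (orbitSum p val a) ⟩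
    pos p *ᶻ dist a b ∎)
    where
    open ≡-Reasoning
    ring : ∀ x y → x -ᶻ (y -ᶻ y) ≡ x
    ring = solve-∀

  κ : Fin p → Fin p → Fin p → ℤ
  κ a b c = desc a b +ᶻ (desc b c -ᶻ desc a c)

  -- On 2i + 1 arguments: the i-th cup power of the generator κ of H²(ℤ/p).
  κ* : ∀ {k} → Cochain (Fin p) k
  κ* [] = 0ℤ
  κ* (a ∷ []) = 1ℤ
  κ* (a ∷ b ∷ []) = 0ℤ
  κ* (a ∷ b ∷ c ∷ xs) = κ a b c *ᶻ κ* (c ∷ xs)

  descκ* valκ* : ∀ {k} → Cochain (Fin p) (suc k)
  descκ* (a ∷ []) = 0ℤ
  descκ* (a ∷ b ∷ xs) = desc a b *ᶻ κ* (b ∷ xs)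
  valκ* (a ∷ xs) = val a *ᶻ κ* (a ∷ xs)

  diffκ* : ∀ {k} → Cochain (Fin p) (suc (suc k))
  diffκ* (a ∷ b ∷ xs) = (val b -ᶻ val a) *ᶻ κ* (b ∷ xs)

  κ*-closed : ∀ {k} (xs : Vec (Fin p) (suc (suc k))) → coboundary κ* xs ≡ 0ℤ
  κ*-exact : ∀ {k} (xs : Vec (Fin p) (suc (suc (suc k)))) → coboundary descκ* xs ≡ κ* xs

  κ*-cut : ∀ {k} b c (xs : Vec (Fin p) k) → coboundary (λ l → κ* (b ∷ l)) (c ∷ xs) ≡ κ* (c ∷ xs)
  κ*-cut b c xs = sym (ℤₚ.i-j≡0⇒i≡j _ _ (κ*-closed (b ∷ c ∷ xs)))

  κ*-closed {zero} (a ∷ b ∷ []) = refl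
  κ*-closed {suc zero} (a ∷ b ∷ c ∷ []) = refl
  κ*-closed {suc (suc k)} xs = trans (coboundary-cong (λ l → sym (κ*-exact l)) xs) (coboundary² descκ* xs)

  κ*-exact (a ∷ b ∷ c ∷ xs) = begin
    desc b c *ᶻ K -ᶻ (desc a c *ᶻ K -ᶻ coboundary (λ l → desc a b *ᶻ κ* (b ∷ l)) (c ∷ xs))
      ≡⟨ cong (λ z → desc b c *ᶻ K -ᶻ (desc a c *ᶻ K -ᶻ z))
           (trans (coboundary-* (desc a b) (λ l → κ* (b ∷ l)) (c ∷ xs)) (cong (desc a b *ᶻ_) (κ*-cut b c xs))) ⟩
    desc b c *ᶻ K -ᶻ (desc a c *ᶻ K -ᶻ desc a b *ᶻ K)
      ≡⟨ ring (desc a b) (desc b c) (desc a c) K ⟩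
    κ a b c *ᶻ K ∎
    where
    open ≡-Reasoning
    K = κ* (c ∷ xs)
    ring : ∀ x y z k → y *ᶻ k -ᶻ (z *ᶻ k -ᶻ x *ᶻ k) ≡ (x +ᶻ (y -ᶻ z)) *ᶻ k
    ring = solve-∀

  coboundary-valκ* : ∀ {k} (xs : Vec (Fin p) (suc (suc k))) → coboundary valκ* xs ≡ diffκ* xs
  coboundary-valκ* (a ∷ b ∷ xs) = trans
    (cong (val b *ᶻ K -ᶻ_) (trans (coboundary-* (val a) (λ l → κ* (a ∷ l)) (b ∷ xs))
      (cong (val a *ᶻ_) (κ*-cut a b xs))))
    (ring (val a) (val b) K)
    where
    K = κ* (b ∷ xs)
    ring : ∀ x y k → y *ᶻ k -ᶻ x *ᶻ k ≡ (y -ᶻ x) *ᶻ k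
    ring = solve-∀

  κ*-rot : ∀ {k} (xs : Vec (Fin p) k) → κ* (map rot xs) ≡ κ* xs
  κ*-rot [] = refl
  κ*-rot (a ∷ []) = refl
  κ*-rot (a ∷ b ∷ []) = refl
  κ*-rot (a ∷ b ∷ c ∷ xs) = cong₂ _*ᶻ_ κ-rot (κ*-rot (c ∷ xs))
    where
    ring : ∀ x y z s t u → x +ᶻ (t -ᶻ s) +ᶻ (y +ᶻ (u -ᶻ t) -ᶻ (z +ᶻ (u -ᶻ s))) ≡ x +ᶻ (y -ᶻ z)
    ring = solve-∀
    κ-rot : κ (rot a) (rot b) (rot c) ≡ κ a b c
    κ-rot rewrite desc-rot a b | desc-rot b c | desc-rot a c =
      ring (desc a b) (desc b c) (desc a c) (top a) (top b) (top c)

  κ*-Repeat : ∀ {k} {xs : Vec (Fin p) k} → Repeat xs → κ* xs ≡ 0ℤ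
  κ*-Repeat {xs = _ ∷ []} (there ())
  κ*-Repeat {xs = _ ∷ _ ∷ []} _ = refl
  κ*-Repeat {xs = a ∷ .a ∷ c ∷ xs} here rewrite desc-refl a =
    trans (cong (_*ᶻ κ* (c ∷ xs)) (ring (desc a c))) (ℤₚ.*-zeroˡ (κ* (c ∷ xs)))
    where
    ring : ∀ x → 0ℤ +ᶻ (x -ᶻ x) ≡ 0ℤ
    ring = solve-∀
  κ*-Repeat {xs = a ∷ b ∷ .b ∷ xs} (there here) rewrite desc-refl b =
    trans (cong (_*ᶻ κ* (b ∷ xs)) (ring (desc a b))) (ℤₚ.*-zeroˡ (κ* (b ∷ xs)))
    where
    ring : ∀ x → x +ᶻ (0ℤ -ᶻ x) ≡ 0ℤ
    ring = solve-∀
  κ*-Repeat {xs = a ∷ b ∷ c ∷ xs} (there (there r)) =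
    trans (cong (κ a b c *ᶻ_) (κ*-Repeat r)) (ℤₚ.*-zeroʳ (κ a b c))

  diffκ*-Repeat : ∀ {k} {xs : Vec (Fin p) (suc (suc k))} → Repeat xs → diffκ* xs ≡ 0ℤ
  diffκ*-Repeat {xs = a ∷ .a ∷ xs} here =
    trans (cong (_*ᶻ κ* (a ∷ xs)) (ℤₚ.+-inverseʳ (val a))) (ℤₚ.*-zeroˡ (κ* (a ∷ xs)))
  diffκ*-Repeat {xs = a ∷ b ∷ xs} (there r) =
    trans (cong ((val b -ᶻ val a) *ᶻ_) (κ*-Repeat r)) (ℤₚ.*-zeroʳ (val b -ᶻ val a))

  Norm-descκ* : ∀ j {k} a b (xs : Vec (Fin p) k) →
    Norm rot j descκ* (a ∷ b ∷ xs) ≡ descents j a b *ᶻ κ* (b ∷ xs)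
  Norm-descκ* zero a b xs = sym (ℤₚ.*-zeroˡ (κ* (b ∷ xs)))
  Norm-descκ* (suc j) a b xs
    rewrite Norm-descκ* j (rot a) (rot b) (map rot xs) | κ*-rot (b ∷ xs) =
    sym (ℤₚ.*-distribʳ-+ (κ* (b ∷ xs)) (desc a b) (descents j (rot a) (rot b)))

  Norm-descκ*≈diffκ* : ∀ {k} (xs : Vec (Fin p) (suc (suc k))) → Norm rot p descκ* xs ≈ diffκ* xs
  Norm-descκ*≈diffκ* (a ∷ b ∷ xs) = ≈-trans
    (≡⇒≈ (trans (Norm-descκ* p a b xs) (cong (_*ᶻ κ* (b ∷ xs)) (descents-full a b))))
    (*-congʳ {b = val b -ᶻ val a} (κ* (b ∷ xs))
      (mod (desc a b) (cong (val b -ᶻ val a +ᶻ_) (ℤₚ.*-comm (pos p) (desc a b)))))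

  δ-valκ* : ∀ {k} (xs : Vec (Fin p) (suc k)) → δ rot valκ* xs ≈ κ* xs
  δ-valκ* (a ∷ xs) = mod (0ℤ -ᶻ top a *ᶻ K)
    (trans (cong₂ (λ x y → x *ᶻ y -ᶻ val a *ᶻ K) (val-rot a) (κ*-rot (a ∷ xs)))
           (ring (val a) (pos p) (top a) K))
    where
    K = κ* (a ∷ xs)
    ring : ∀ x q t k → (x +ᶻ 1ℤ -ᶻ q *ᶻ t) *ᶻ k -ᶻ x *ᶻ k ≡ k +ᶻ (0ℤ -ᶻ t *ᶻ k) *ᶻ q
    ring = solve-∀

  Equivariant : ∀ {n} → (SignVector n → Fin p) → Set
  Equivariant s = ∀ x → 0 < weight x → s (rotate x) ≡ rot (s x)

  map-equivariant : ∀ {n k} (s : SignVector n → Fin p) → Equivariant s →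
    ∀ {y} (xs : Vec (SignVector n) k) → Chain y xs → map s (map rotate xs) ≡ map rot (map s xs)
  map-equivariant s eq [] _ = refl
  map-equivariant s eq (x ∷ xs) ((_ , l) , c) =
    cong₂ _∷_ (eq x (ℕₚ.≤-<-trans z≤n l)) (map-equivariant s eq xs c)

  Norm-equivariant : ∀ {n k} (s : SignVector n → Fin p) → Equivariant s →
    ∀ j (F : Cochain (Fin p) k) xs → Chain 𝟎 xs →
    Norm rotate j (F ∘ map s) xs ≡ Norm rot j F (map s xs)
  Norm-equivariant s eq zero F xs c = refl
  Norm-equivariant s eq (suc j) F xs c = cong (F (map s xs) +ᶻ_)
    (trans (Norm-equivariant s eq j F (map rotate xs) (rotate-Chain xs c))
           (cong (Norm rot j F) (map-equivariant s eq xs c)))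

  double : ℕ → ℕ
  double zero = zero
  double (suc i) = suc (suc (double i))

  ν-odd : ∀ i {n k} (F : Cochain (SignVector n) k) xs → ν (suc (double i)) F xs ≡ δ rotate F xs
  ν-odd zero F xs = refl
  ν-odd (suc i) F xs = ν-odd i F xs

  ν-even : ∀ i {n k} (F : Cochain (SignVector n) k) xs →
    ν (suc (suc (double i))) F xs ≡ Norm rotate p F xs
  ν-even zero F xs = refl
  ν-even (suc i) F xs = ν-even i F xs

  module _ {n} (s : SignVector (suc n) → Fin p) where

    map-∘-ι : ∀ {k} (xs : Vec (SignVector n) k) → map s (map ι xs) ≡ map (s ∘ ι) xs
    map-∘-ι xs = sym (Vecₚ.map-∘ s ι xs)

    I-pullback : (F : Cochain (Fin p) n) →
      I (suc n) (coboundary F ∘ map s) ≈ I n (ν n (F ∘ map (s ∘ ι)))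
    I-pullback F = ≈-trans
      (I-cong (suc n) (λ xs _ → ≡⇒≈ (sym (coboundary-map s F xs))))
      (≈-trans (Stokes n (F ∘ map s))
        (I-cong n (ν-cong n (λ xs _ → ≡⇒≈ (cong F (map-∘-ι xs))))))

  I-diffκ* : ∀ i (s : SignVector (suc (suc (double i))) → Fin p) → Equivariant s →
    I _ (diffκ* ∘ map s) ≈ I _ (κ* ∘ map (s ∘ ι))
  I-diffκ* i s eq = ≈-trans
    (I-cong _ (λ xs _ → ≡⇒≈ (sym (coboundary-valκ* (map s xs)))))
    (≈-trans (I-pullback s valκ*)
      (I-cong _ (λ xs c → ≈-trans (≡⇒≈ (ν-odd i (valκ* ∘ map (s ∘ ι)) xs))
        (≈-trans (≡⇒≈ (cong (λ l → valκ* l -ᶻ valκ* (map (s ∘ ι) xs))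
                   (map-equivariant (s ∘ ι) (eq ∘ ι) xs c)))
          (δ-valκ* (map (s ∘ ι) xs))))))

  I-κ* : ∀ i (s : SignVector (suc (suc (suc (double i)))) → Fin p) → Equivariant s →
    I _ (κ* ∘ map s) ≈ I _ (diffκ* ∘ map (s ∘ ι))
  I-κ* i s eq = ≈-trans
    (I-cong _ (λ xs _ → ≡⇒≈ (sym (κ*-exact (map s xs)))))
    (≈-trans (I-pullback s descκ*)
      (I-cong _ (λ xs c → ≈-trans
        (≡⇒≈ (trans (ν-even i (descκ* ∘ map (s ∘ ι)) xs)
                    (Norm-equivariant (s ∘ ι) (eq ∘ ι) p descκ* xs c)))
        (Norm-descκ*≈diffκ* (map (s ∘ ι) xs)))))

  I-κ*≈1 : ∀ i (s : SignVector (suc (double i)) → Fin p) → Equivariant s → I _ (κ* ∘ map s) ≈ 1ℤ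
  I-κ*≈1 zero s eq = ≡⇒≈ refl
  I-κ*≈1 (suc i) s eq = ≈-trans (I-κ* i s eq)
    (≈-trans (I-diffκ* i (s ∘ ι) (eq ∘ ι)) (I-κ*≈1 i (s ∘ ι ∘ ι) (eq ∘ ι ∘ ι)))

  1≉0 : 1 < p → ¬ 1ℤ ≈ 0ℤ
  1≉0 1<p (mod k e) = ℕₚ.<⇒≱ 1<p (∣⇒≤ (divides ∣ k ∣
    (trans (cong ∣_∣ (trans e (ℤₚ.+-identityˡ (k *ᶻ pos p)))) (ℤₚ.abs-* k (pos p)))))

  halve : ∀ n → (∃ λ i → n ≡ double i) ⊎ (∃ λ i → n ≡ suc (double i))
  halve zero = inj₁ (zero , refl)
  halve (suc n) with halve n
  ... | inj₁ (i , refl) = inj₂ (i , refl)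
  ... | inj₂ (i , refl) = inj₁ (suc i , refl)

  Tucker : 1 < p → ∀ {n} (s : SignVector (suc n) → Fin p) → Equivariant s →
    ¬ (∀ (xs : Vec (SignVector (suc n)) (suc n)) → Chain 𝟎 xs → Repeat (map s xs))
  Tucker 1<p {n} s eq rep with halve n
  ... | inj₁ (i , refl) = 1≉0 1<p (≈-trans (≈-sym (I-κ*≈1 i s eq))
    (≈-trans (I-cong _ (λ xs c → ≡⇒≈ (κ*-Repeat (rep xs c)))) (I-0 (suc (double i)))))
  ... | inj₂ (i , refl) = 1≉0 1<p (≈-trans (≈-sym (≈-trans (I-diffκ* i s eq) (I-κ*≈1 i (s ∘ ι) (eq ∘ ι))))
    (≈-trans (I-cong _ (λ xs c → ≡⇒≈ (diffκ*-Repeat (rep xs c)))) (I-0 (suc (suc (double i))))))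

-- The Alon–Frankl–Lovász theorem

record Matching {n t : ℕ} (col : Subset n → Fin t) (W : Subset n) (r k : ℕ) (c : Fin t) : Set where
  field
    sets     : Fin k → Subset n
    within   : ∀ i → sets i ⊆ W
    size     : ∀ i → card (sets i) ≡ r
    coloured : ∀ i → col (sets i) ≡ c
    disjoint : ∀ i j → i ≢ j → Empty (sets i ∩ sets j)

subset-of-size : ∀ {n} r (W : Subset n) → r ≤ card W → ∃ λ S → S ⊆ W × card S ≡ r
subset-of-size {n} zero W _ = None , ⊥-elim ∘ Subsetₚ.∉⊥ , Subsetₚ.∣⊥∣≡0 n
subset-of-size (suc r) (inside ∷ W) (s≤s h) with subset-of-size r W h
... | S , sub , e = inside ∷ S , Subsetₚ.s⊆s sub , cong suc e
subset-of-size (suc r) (outside ∷ W) h with subset-of-size (suc r) W h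
... | S , sub , e = outside ∷ S , Subsetₚ.s⊆s sub , e

sumFin : ∀ {t} → (Fin t → ℕ) → ℕ
sumFin {zero} f = 0
sumFin {suc t} f = f zero + sumFin (f ∘ suc)

sumFin-mono : ∀ {t} {f g : Fin t → ℕ} → (∀ i → f i ≤ g i) → sumFin f ≤ sumFin g
sumFin-mono {zero} h = z≤n
sumFin-mono {suc t} h = ℕₚ.+-mono-≤ (h zero) (sumFin-mono (h ∘ suc))

sumFin-const : ∀ t b → sumFin {t} (λ _ → b) ≡ t * b
sumFin-const zero b = refl
sumFin-const (suc t) b = cong (b +_) (sumFin-const t b)

sumFin-term : ∀ {t} (f : Fin t → ℕ) i → f i ≤ sumFin f
sumFin-term f zero = ℕₚ.m≤m+n _ _
sumFin-term f (suc i) = ℕₚ.≤-trans (sumFin-term (f ∘ suc) i) (ℕₚ.m≤n+m _ _)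

+-squeeze : ∀ {a b c d} → a ≤ c → b ≤ d → a + b ≡ c + d → a ≡ c × b ≡ d
+-squeeze {a} {b} {c} {d} a≤c b≤d e with ℕₚ.m≤n⇒m<n∨m≡n a≤c
... | inj₁ a<c = contradiction e (ℕₚ.<⇒≢ (ℕₚ.+-mono-<-≤ a<c b≤d))
... | inj₂ refl = refl , ℕₚ.+-cancelˡ-≡ a b d e

sumFin-squeeze : ∀ {t} {f g : Fin t → ℕ} → (∀ i → f i ≤ g i) → sumFin f ≡ sumFin g → ∀ i → f i ≡ g i
sumFin-squeeze {suc t} h e i with +-squeeze (h zero) (sumFin-mono (h ∘ suc)) e
sumFin-squeeze h e zero | e₀ , _ = e₀
sumFin-squeeze h e (suc i) | _ , e₁ = sumFin-squeeze (h ∘ suc) e₁ i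

sumFin-cong : ∀ {t} {f g : Fin t → ℕ} → (∀ i → f i ≡ g i) → sumFin f ≡ sumFin g
sumFin-cong {zero} h = refl
sumFin-cong {suc t} h = cong₂ _+_ (h zero) (sumFin-cong (h ∘ suc))

anyVec? : {A : Set} → (∀ {P : A → Set} → (∀ a → Dec (P a)) → Dec (∃ P)) →
  ∀ {n} {P : Vec A n → Set} → (∀ v → Dec (P v)) → Dec (∃ P)
anyVec? any {zero} P? = map′ (λ h → [] , h) (λ { ([] , h) → h }) (P? [])
anyVec? any {suc n} P? = map′ (λ { (a , v , h) → a ∷ v , h }) (λ { (a ∷ v , h) → a , v , h })
  (any (λ a → anyVec? any (λ v → P? (a ∷ v))))

anyMaybe? : ∀ {m} {P : Maybe (Fin m) → Set} → (∀ a → Dec (P a)) → Dec (∃ P)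
anyMaybe? P? with P? nothing
... | yes h = yes (nothing , h)
... | no h = map′ (λ { (a , h') → just a , h' })
  (λ { (nothing , h') → ⊥-elim (h h') ; (just a , h') → a , h' }) (Finₚ.any? (P? ∘ just))

indicator : Bool → ℕ
indicator b = if b then 1 else 0

indicator≤1 : ∀ b → indicator b ≤ 1
indicator≤1 true = s≤s z≤n
indicator≤1 false = z≤n

indicator-injective : ∀ {a b} → indicator a ≡ indicator b → a ≡ b
indicator-injective {true} {true} _ = refl
indicator-injective {false} {false} _ = refl

card-∷ : ∀ {n} b (S : Subset n) → card (b ∷ S) ≡ indicator b + card S
card-∷ true S = refl
card-∷ false S = refl

module Means (p' : ℕ) (p-prime : Prime (suc p')) where

  open Cyclic p' public

  1<p : 1 < p
  1<p = ℕ.nonTrivial⇒n>1 p {{prime⇒nonTrivial p-prime}}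

  iter-rot-surjective : ∀ b → ∃ λ i → i < p × iter rot i zero ≡ b
  iter-rot-surjective b = toℕ b , Finₚ.toℕ<n b , iter-rot-zero b

  rot-injective : ∀ {a b} → rot a ≡ rot b → a ≡ b
  rot-injective {a} {b} e = trans (sym (rot-order a)) (trans (cong (iter rot p') e) (rot-order b))

  count : ℕ → (Fin p → Bool) → Fin p → ℕ
  count zero S a = 0
  count (suc j) S a = indicator (S a) + count j S (rot a)

  count-mono : ∀ j {S S' : Fin p → Bool} → (∀ b → indicator (S b) ≤ indicator (S' b)) →
    ∀ a → count j S a ≤ count j S' a
  count-mono zero h a = z≤n
  count-mono (suc j) h a = ℕₚ.+-mono-≤ (h a) (count-mono j h (rot a))

  count-squeeze : ∀ j {S S' : Fin p → Bool} → (∀ b → indicator (S b) ≤ indicator (S' b)) →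
    ∀ a → count j S a ≡ count j S' a → ∀ i → i < j → S (iter rot i a) ≡ S' (iter rot i a)
  count-squeeze (suc j) h a e i i<j with +-squeeze (h a) (count-mono j h (rot a)) e
  count-squeeze (suc j) h a e zero _ | e₀ , _ = indicator-injective e₀
  count-squeeze (suc j) h a e (suc i) (s≤s i<j) | _ , e₁ = count-squeeze j h (rot a) e₁ i i<j

  count-true : ∀ j a → count j (λ _ → true) a ≡ j
  count-true zero a = refl
  count-true (suc j) a = cong suc (count-true j (rot a))

  count-false : ∀ j a → count j (λ _ → false) a ≡ 0
  count-false zero a = refl
  count-false (suc j) a = count-false j (rot a)

  ∥_∥ : (Fin p → Bool) → ℕ
  ∥ S ∥ = count p S zero

  ∥∥-squeeze : ∀ {S S' : Fin p → Bool} → (∀ b → indicator (S b) ≤ indicator (S' b)) →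
    ∥ S ∥ ≡ ∥ S' ∥ → ∀ b → S b ≡ S' b
  ∥∥-squeeze {S} {S'} h e b with iter-rot-surjective b
  ... | i , i<p , refl = count-squeeze p {S} {S'} h zero e i i<p

  ∥∥≤p' : ∀ {S : Fin p → Bool} → ¬ (∀ b → S b ≡ true) → ∥ S ∥ ≤ p'
  ∥∥≤p' {S} ¬full with ℕₚ.m≤n⇒m<n∨m≡n (subst (∥ S ∥ ≤_) (count-true p zero)
                       (count-mono p {S} {λ _ → true} (λ b → indicator≤1 (S b)) zero))
  ... | inj₁ l = ℕₚ.≤-pred l
  ... | inj₂ e = contradiction
    (∥∥-squeeze {S} {λ _ → true} (λ b → indicator≤1 (S b)) (trans e (sym (count-true p zero)))) ¬full

  ∥∥>0 : ∀ {S : Fin p → Bool} b → S b ≡ true → 0 < ∥ S ∥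
  ∥∥>0 {S} b Sb with ℕₚ.m≤n⇒m<n∨m≡n (z≤n {∥ S ∥})
  ... | inj₁ l = l
  ... | inj₂ e with trans (∥∥-squeeze {λ _ → false} {S} (λ _ → z≤n) (trans (count-false p zero) e) b) Sb
  ...   | ()

  orbitSum-shift : ∀ j (f : Fin p → ℤ) a → orbitSum j f (rot a) ≡ orbitSum j (f ∘ rot) a
  orbitSum-shift zero f a = refl
  orbitSum-shift (suc j) f a = cong (f (rot a) +ᶻ_) (orbitSum-shift j f (rot a))

  orbitSum-≈ : ∀ j {f g : Fin p → ℤ} → (∀ b → f b ≈ g b) → ∀ a → orbitSum j f a ≈ orbitSum j g a
  orbitSum-≈ zero h a = ≡⇒≈ refl
  orbitSum-≈ (suc j) h a = +-cong (h a) (orbitSum-≈ j h (rot a))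

  orbitSum-cong : ∀ j {f g : Fin p → ℤ} → (∀ b → f b ≡ g b) → ∀ a → orbitSum j f a ≡ orbitSum j g a
  orbitSum-cong zero h a = refl
  orbitSum-cong (suc j) h a = cong₂ _+ᶻ_ (h a) (orbitSum-cong j h (rot a))

  orbitSum-+ : ∀ j (f g : Fin p → ℤ) a →
    orbitSum j (λ b → f b +ᶻ g b) a ≡ orbitSum j f a +ᶻ orbitSum j g a
  orbitSum-+ zero f g a = refl
  orbitSum-+ (suc j) f g a rewrite orbitSum-+ j f g (rot a) =
    ring (f a) (g a) (orbitSum j f (rot a)) (orbitSum j g (rot a))
    where
    ring : ∀ x y z w → x +ᶻ y +ᶻ (z +ᶻ w) ≡ x +ᶻ z +ᶻ (y +ᶻ w)
    ring = solve-∀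

  weigh : (Fin p → Bool) → Fin p → ℤ
  weigh S b = pos (indicator (S b))

  count-orbitSum : ∀ j S a → pos (count j S a) ≡ orbitSum j (weigh S) a
  count-orbitSum zero S a = refl
  count-orbitSum (suc j) S a = cong (weigh S a +ᶻ_) (count-orbitSum j S (rot a))

  moment : (Fin p → Bool) → ℤ
  moment S = orbitSum p (λ b → weigh S b *ᶻ val b) zero

  Rotated : (S S' : Fin p → Bool) → Set
  Rotated S S' = ∀ b → S' (rot b) ≡ S b

  orbitSum-reindex : ∀ (f : Fin p → ℤ) → orbitSum p f zero ≡ orbitSum p (f ∘ rot) zero
  orbitSum-reindex f = trans (sym (orbitSum-full-rot f zero)) (orbitSum-shift p f zero)

  ∥∥-rot : ∀ S S' → Rotated S S' → ∥ S' ∥ ≡ ∥ S ∥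
  ∥∥-rot S S' h = ℤₚ.+-injective (begin
    pos ∥ S' ∥                            ≡⟨ count-orbitSum p S' zero ⟩
    orbitSum p (weigh S') zero          ≡⟨ orbitSum-reindex (weigh S') ⟩
    orbitSum p (weigh S' ∘ rot) zero    ≡⟨ orbitSum-cong p (λ b → cong (pos ∘ indicator) (h b)) zero ⟩
    orbitSum p (weigh S) zero           ≡⟨ count-orbitSum p S zero ⟨
    pos ∥ S ∥                             ∎)
    where open ≡-Reasoning

  moment-rot : ∀ S S' → Rotated S S' → moment S' ≈ moment S +ᶻ pos ∥ S ∥
  moment-rot S S' h = ≈-trans
    (≡⇒≈ (orbitSum-reindex (λ b → weigh S' b *ᶻ val b)))
    (≈-trans (orbitSum-≈ p {g = λ b → weigh S b *ᶻ val b +ᶻ weigh S b} term zero)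
      (≡⇒≈ (trans (orbitSum-+ p (λ b → weigh S b *ᶻ val b) (weigh S) zero)
                  (cong (moment S +ᶻ_) (sym (count-orbitSum p S zero))))))
    where
    ring : ∀ w x q t → w *ᶻ (x +ᶻ 1ℤ -ᶻ q *ᶻ t) ≡ w *ᶻ x +ᶻ w +ᶻ (0ℤ -ᶻ w *ᶻ t) *ᶻ q
    ring = solve-∀
    term : ∀ b → weigh S' (rot b) *ᶻ val (rot b) ≈ weigh S b *ᶻ val b +ᶻ weigh S b
    term b = mod (0ℤ -ᶻ weigh S b *ᶻ top b)
      (trans (cong₂ _*ᶻ_ (cong (pos ∘ indicator) (h b)) (val-rot b))
             (ring (weigh S b) (val b) (pos p) (top b)))

  residue : ℤ → Fin p
  residue z = fromℕ< (n%ℕd<d z p)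

  val-residue : ∀ z → val (residue z) ≈ z
  val-residue z = ≈-sym (mod (z /ℕ p) (trans (a≡a%ℕn+[a/ℕn]*n z p)
    (cong (λ y → pos y +ᶻ (z /ℕ p) *ᶻ pos p) (sym (Finₚ.toℕ-fromℕ< (n%ℕd<d z p))))))

  val-injective : ∀ {a b} → val a ≈ val b → a ≡ b
  val-injective {a} {b} (mod k e) = Finₚ.toℕ-injective (ℤₚ.+-injective (begin
    val a                       ≡⟨ e ⟩
    val b +ᶻ k *ᶻ pos p           ≡⟨ cong (λ l → val b +ᶻ l *ᶻ pos p) k≡0 ⟩
    val b +ᶻ 0ℤ                 ≡⟨ ℤₚ.+-identityʳ (val b) ⟩
    val b                       ∎))
    where
    open ≡-Reasoning
    k*p : k *ᶻ pos p ≡ val a -ᶻ val b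
    k*p = trans (ring (val b) (k *ᶻ pos p)) (cong (_-ᶻ val b) (sym e))
      where
      ring : ∀ x y → y ≡ x +ᶻ y -ᶻ x
      ring = solve-∀
    small : ∣ k ∣ * p < p
    small = ℕₚ.≤-<-trans
      (ℕₚ.≤-reflexive (trans (sym (ℤₚ.abs-* k (pos p))) (cong ∣_∣ (trans k*p (ℤₚ.m-n≡m⊖n (toℕ a) (toℕ b))))))
      (ℕₚ.≤-<-trans (ℤₚ.∣m⊝n∣≤m⊔n (toℕ a) (toℕ b)) (ℕₚ.⊔-lub (Finₚ.toℕ<n a) (Finₚ.toℕ<n b)))
    k≡0 : k ≡ 0ℤ
    k≡0 = ℤₚ.∣i∣≡0⇒i≡0 (ℕₚ.n<1⇒n≡0 (ℕₚ.*-cancelʳ-< p ∣ k ∣ 1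
      (subst (∣ k ∣ * p <_) (sym (ℕₚ.*-identityˡ p)) small)))

  residue-rot : ∀ {y z} → y ≈ z +ᶻ 1ℤ → residue y ≡ rot (residue z)
  residue-rot {y} {z} h = val-injective (≈-trans (val-residue y) (≈-trans h
    (≈-trans (+-cong (≈-sym (val-residue z)) (≡⇒≈ {1ℤ} refl))
      (mod (top (residue z)) (trans (ring (val (residue z)) (top (residue z)) (pos p))
        (cong (_+ᶻ top (residue z) *ᶻ pos p) (sym (val-rot (residue z)))))))))
    where
    ring : ∀ x t q → x +ᶻ 1ℤ ≡ x +ᶻ 1ℤ -ᶻ q *ᶻ t +ᶻ t *ᶻ q
    ring = solve-∀

  inverse : ℕ → ℤ
  inverse m with coprime? p m
  ... | no _ = 0ℤ
  ... | yes c with coprime-Bézout c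
  ...   | Bézout.+- x y eq = neg (pos y)
  ...   | Bézout.-+ x y eq = pos y

  inverse-* : ∀ m → 0 < m → m < p → pos m *ᶻ inverse m ≈ 1ℤ
  inverse-* m@(suc _) _ m<p with coprime? p m
  ... | no ¬c = ⊥-elim (¬c (prime⇒coprime p-prime m<p))
  ... | yes c with coprime-Bézout c
  ...   | Bézout.+- x y eq = mod (neg (pos x)) (trans (ring (pos m) (pos y) )
            (cong (λ z → 1ℤ +ᶻ z) (trans (cong neg (trans (cong (1ℤ +ᶻ_) (sym (ℤₚ.pos-* y m)))
              (trans (cong pos eq) (ℤₚ.pos-* x p)))) (ring₂ (pos x) (pos p)))))
    where
    ring : ∀ m y → m *ᶻ (neg y) ≡ 1ℤ +ᶻ (neg (1ℤ +ᶻ y *ᶻ m))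
    ring = solve-∀
    ring₂ : ∀ x q → neg (x *ᶻ q) ≡ (neg x) *ᶻ q
    ring₂ = solve-∀
  ...   | Bézout.-+ x y eq = mod (pos x) (trans (ℤₚ.*-comm (pos m) (pos y)) (trans (sym (ℤₚ.pos-* y m))
            (trans (cong pos (sym eq)) (cong (1ℤ +ᶻ_) (ℤₚ.pos-* x p)))))

  -- Averaging is what needs p prime: the size of the set has to be invertible.
  mean : (Fin p → Bool) → Fin p
  mean S = residue (moment S *ᶻ inverse ∥ S ∥)

  mean-rot : ∀ S S' → 0 < ∥ S ∥ → ∥ S ∥ < p → Rotated S S' → mean S' ≡ rot (mean S)
  mean-rot S S' l u h = residue-rot {z = moment S *ᶻ inverse ∥ S ∥} (≈-trans
    (≡⇒≈ (cong (λ m → moment S' *ᶻ inverse m) (∥∥-rot S S' h)))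
    (≈-trans (*-congʳ (inverse ∥ S ∥) (moment-rot S S' h))
      (≈-trans (≡⇒≈ (ℤₚ.*-distribʳ-+ (inverse ∥ S ∥) (moment S) (pos ∥ S ∥)))
        (+-cong (≡⇒≈ {moment S *ᶻ inverse ∥ S ∥} refl) (inverse-* ∥ S ∥ l u)))))

  count-cong : ∀ j {S S' : Fin p → Bool} → (∀ b → S b ≡ S' b) → ∀ a → count j S a ≡ count j S' a
  count-cong zero h a = refl
  count-cong (suc j) h a = cong₂ _+_ (cong indicator (h a)) (count-cong j h (rot a))

  mean-cong : ∀ {S S' : Fin p → Bool} → (∀ b → S b ≡ S' b) → mean S ≡ mean S'
  mean-cong h = cong₂ (λ x m → residue (x *ᶻ inverse m))
    (orbitSum-cong p (λ b → cong (λ z → pos (indicator z) *ᶻ val b) (h b)) zero) (count-cong p h zero)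

  select : ∀ {t} → (Fin t → Fin p → Bool) → Fin p
  select {zero} S = zero
  select {suc t} S with ∥ S zero ∥
  ... | zero = select (S ∘ suc)
  ... | suc _ = mean (S zero)

  select-cong : ∀ {t} {S S' : Fin t → Fin p → Bool} → (∀ c b → S c b ≡ S' c b) → select S ≡ select S'
  select-cong {zero} h = refl
  select-cong {suc t} {S} {S'} h with ∥ S zero ∥ | ∥ S' zero ∥ | count-cong p (h zero) zero
  ... | zero | zero | refl = select-cong (h ∘ suc)
  ... | suc _ | suc _ | _ = mean-cong (h zero)

  select-rot : ∀ {t} {S S' : Fin t → Fin p → Bool} → (∀ c → ∥ S c ∥ < p) → (∃ λ c → 0 < ∥ S c ∥) →
    (∀ c → Rotated (S c) (S' c)) → select S' ≡ rot (select S)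
  select-rot {suc t} {S} {S'} u (c , l) h
    with ∥ S zero ∥ in e | ∥ S' zero ∥ | ∥∥-rot (S zero) (S' zero) (h zero)
  ... | suc _ | suc _ | _ = mean-rot (S zero) (S' zero) (subst (0 <_) (sym e) ℕ.z<s) (u zero) (h zero)
  ... | zero | suc _ | ()
  ... | suc _ | zero | ()
  ... | zero | zero | _ with c
  ...   | zero = contradiction (subst (0 <_) e l) (ℕₚ.<-irrefl refl)
  ...   | suc c' = select-rot (u ∘ suc) (c' , l) (h ∘ suc)

module PrimeMatching (p' : ℕ) (p-prime : Prime (suc p')) (t' r' : ℕ) {n : ℕ}
                     (col : Subset n → Fin (suc t')) where

  open Means p' p-prime

  r : ℕ
  r = suc r'

  -- A sign vector is read as the family of its p disjoint classes.
  occursAs : Fin p → Maybe (Fin p) → Bool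
  occursAs a nothing = outside
  occursAs a (just b) = does (b Finₚ.≟ a)

  class : ∀ {m} → SignVector m → Fin p → Subset m
  class x a = map (occursAs a) x

  Contains : Fin (suc t') → Subset n → Set
  Contains c W = ∃ λ S → S ⊆ W × card S ≡ r × col S ≡ c

  contains? : ∀ c W → Dec (Contains c W)
  contains? c W = Subsetₚ.anySubset? (λ S → S Subsetₚ.⊆? W ×-dec (card S ℕ.≟ r ×-dec col S Finₚ.≟ c))

  Full-class : Set
  Full-class = ∃ λ (x : SignVector n) → ∃ λ c → ∀ a → Contains c (class x a)

  full-class? : Dec Full-class
  full-class? = anyVec? anyMaybe? (λ x → Finₚ.any? (λ c → Finₚ.all? (λ a → contains? c (class x a))))

  occursAs-true : ∀ a b → occursAs a (just b) ≡ true → b ≡ a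
  occursAs-true a b e with b Finₚ.≟ a
  ... | yes h = h

  class-disjoint : ∀ {m} (x : SignVector m) {a b} → a ≢ b → ∀ {i} → i ∈ class x a → i ∈ class x b → ⊥
  class-disjoint (just y ∷ x) {a} {b} a≢b {zero} p q =
    a≢b (trans (sym (occursAs-true a y (Vecₚ.[]=⇒lookup p))) (occursAs-true b y (Vecₚ.[]=⇒lookup q)))
  class-disjoint (y ∷ x) a≢b {suc i} (there p) (there q) = class-disjoint x a≢b p q

  full-class⇒Matching : Full-class → ∃ (Matching col Full r p)
  full-class⇒Matching (x , c , h) = c , record
    { sets = proj₁ ∘ h
    ; within = λ i _ → Subsetₚ.∈⊤
    ; size = λ i → proj₁ (proj₂ (proj₂ (h i)))
    ; coloured = λ i → proj₂ (proj₂ (proj₂ (h i)))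
    ; disjoint = λ { i j i≢j (k , k∈) → class-disjoint x i≢j
        (proj₁ (proj₂ (h i)) (proj₁ (Subsetₚ.x∈p∩q⁻ _ _ k∈)))
        (proj₁ (proj₂ (h j)) (proj₂ (Subsetₚ.x∈p∩q⁻ _ _ k∈))) }
    }

  palette : SignVector n → Fin (suc t') → Fin p → Bool
  palette x c a = does (contains? c (class x a))

  class-rotate : ∀ {m} (x : SignVector m) a → class (rotate x) (rot a) ≡ class x a
  class-rotate x a = trans (sym (Vecₚ.map-∘ _ _ x)) (Vecₚ.map-cong entry x)
    where
    entry : ∀ y → occursAs (rot a) (Maybe.map rot y) ≡ occursAs a y
    entry nothing = refl
    entry (just b) with b Finₚ.≟ a
    ... | yes refl = dec-true (rot b Finₚ.≟ rot b) refl
    ... | no b≢a = dec-false (rot b Finₚ.≟ rot a) (b≢a ∘ rot-injective)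

  palette-rotate : ∀ x c → Rotated (palette x c) (palette (rotate x) c)
  palette-rotate x c a = cong (does ∘ contains? c) (class-rotate x a)

  class-mono : ∀ {m} {x y : SignVector m} → Pointwise _≼_ x y → ∀ a → class x a ⊆ class y a
  class-mono (none ∷ _) a {zero} h with Vecₚ.[]=⇒lookup h
  ... | ()
  class-mono {y = y} (same ∷ _) a {zero} h = Vecₚ.lookup⇒[]= zero (class y a) (Vecₚ.[]=⇒lookup h)
  class-mono (_ ∷ l) a {suc i} (there h) = there (class-mono l a h)

  palette-mono : ∀ {x y} → Pointwise _≼_ x y → ∀ c a →
    indicator (palette x c a) ≤ indicator (palette y c a)
  palette-mono {x} {y} x≼y c a with contains? c (class x a)
  ... | no _ = z≤n
  ... | yes (S , S⊆ , h) =
    ℕₚ.≤-reflexive (cong indicator (sym (dec-true (contains? c (class y a))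
      (S , class-mono x≼y a ∘ S⊆ , h))))

  weight-classes : ∀ {m} (x : SignVector m) → weight x ≡ sumFin (λ a → card (class x a))
  weight-classes [] = sym (trans (sumFin-const p 0) (ℕₚ.*-zeroʳ p))
  weight-classes (nothing ∷ x) = weight-classes x
  weight-classes (just b ∷ x) = begin
    suc (weight x)
      ≡⟨ cong suc (weight-classes x) ⟩
    suc (sumFin (λ a → card (class x a)))
      ≡⟨ sumFin-mark b (λ a → card (class x a)) ⟨
    sumFin (λ a → indicator (does (b Finₚ.≟ a)) + card (class x a))
      ≡⟨ sumFin-cong (λ a → card-∷ (does (b Finₚ.≟ a)) (class x a)) ⟨
    sumFin (λ a → card (class (just b ∷ x) a)) ∎
    where
    open ≡-Reasoning
    sumFin-mark : ∀ {t} (b : Fin t) (f : Fin t → ℕ) →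
      sumFin (λ a → indicator (does (b Finₚ.≟ a)) + f a) ≡ suc (sumFin f)
    sumFin-mark zero f = refl
    sumFin-mark (suc b) f = trans
      (cong (f zero +_) (sumFin-mark b (f ∘ suc))) (ℕₚ.+-suc (f zero) (sumFin (f ∘ suc)))

  threshold : ℕ
  threshold = p * r'

  large-class : ∀ {m} (x : SignVector m) → threshold < weight x → ∃ λ a → r ≤ card (class x a)
  large-class x l with Finₚ.any? (λ a → r ℕ.≤? card (class x a))
  ... | yes h = h
  ... | no ¬h = contradiction (ℕₚ.≤-trans (ℕₚ.≤-reflexive (weight-classes x))
    (ℕₚ.≤-trans (sumFin-mono (λ a → ℕₚ.≤-pred (ℕₚ.≰⇒> (λ h → ¬h (a , h)))))
                (ℕₚ.≤-reflexive (sumFin-const p r')))) (ℕₚ.<⇒≱ l)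

  palette-nonempty : ∀ x → threshold < weight x → ∃ λ c → 0 < ∥ palette x c ∥
  palette-nonempty x l with large-class x l
  ... | a , h with subset-of-size r (class x a) h
  ...   | S , S⊆ , e = col S , ∥∥>0 a (dec-true (contains? (col S) (class x a)) (S , S⊆ , e , refl))

  first : ∀ {m} → SignVector m → Fin p
  first [] = zero
  first (nothing ∷ x) = first x
  first (just a ∷ x) = a

  first-rotate : ∀ {m} (x : SignVector m) → 0 < weight x → first (rotate x) ≡ rot (first x)
  first-rotate (nothing ∷ x) l = first-rotate x l
  first-rotate (just a ∷ x) l = refl

  total : SignVector n → ℕ
  total x = sumFin (λ c → ∥ palette x c ∥)

  -- Light vectors are ranked by weight, heavy ones by the colours that occur in their classes.
  sgn : SignVector n → Fin p
  sgn x with weight x ℕ.≤? threshold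
  ... | yes _ = first x
  ... | no _ = select (palette x)

  rank : SignVector n → ℕ
  rank x with weight x ℕ.≤? threshold
  ... | yes _ = weight x
  ... | no _ = threshold + total x

  module _ (¬full : ¬ Full-class) where

    palette-proper : ∀ x c → ∥ palette x c ∥ ≤ p'
    palette-proper x c = ∥∥≤p' (λ h → ¬full (x , c , λ a → witness (contains? c (class x a)) (h a)))
      where
      witness : ∀ {A : Set} (d : Dec A) → does d ≡ true → A
      witness (yes a) _ = a

    sgn-equivariant : Equivariant sgn
    sgn-equivariant x l with weight x ℕ.≤? threshold | weight (rotate x) ℕ.≤? threshold | weight-rotate x
    ... | yes _ | yes _ | _ = first-rotate x l
    ... | no h | no _ | _ = select-rot {S = palette x} {palette (rotate x)}
      (λ c → s≤s (palette-proper x c)) (palette-nonempty x (ℕₚ.≰⇒> h)) (palette-rotate x)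
    ... | yes h | no ¬h | e = contradiction (subst (_≤ threshold) (sym e) h) ¬h
    ... | no ¬h | yes h | e = contradiction (subst (_≤ threshold) e h) ¬h

    rank-bound : ∀ x → rank x ≤ threshold + suc t' * p'
    rank-bound x with weight x ℕ.≤? threshold
    ... | yes h = ℕₚ.≤-trans h (ℕₚ.m≤m+n _ _)
    ... | no _ = ℕₚ.+-monoʳ-≤ threshold (ℕₚ.≤-trans (sumFin-mono (palette-proper x))
                   (ℕₚ.≤-reflexive (sumFin-const (suc t') p')))

    rank-positive : ∀ x → 0 < weight x → 0 < rank x
    rank-positive x l with weight x ℕ.≤? threshold
    ... | yes _ = l
    ... | no h with palette-nonempty x (ℕₚ.≰⇒> h)
    ...   | c , q = ℕₚ.<-≤-trans q (ℕₚ.≤-trans (sumFin-term (λ c → ∥ palette x c ∥) c)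
                                               (ℕₚ.m≤n+m (total x) threshold))

    -- Palettes grow along a chain, so on a chain the rank determines the sign.
    rank-step : ∀ {x y} → x ⊏ y → sgn x ≡ sgn y ⊎ rank x < rank y
    rank-step {x} {y} (x≼y , l) with weight x ℕ.≤? threshold | weight y ℕ.≤? threshold
    ... | yes _ | yes _ = inj₂ l
    ... | no ¬h | yes h = contradiction (ℕₚ.≤-trans (ℕₚ.<⇒≤ l) h) ¬h
    ... | yes h | no ¬h with palette-nonempty y (ℕₚ.≰⇒> ¬h)
    ...   | c , q = inj₂ (ℕₚ.≤-<-trans h (ℕₚ.m<m+n threshold
                      (ℕₚ.<-≤-trans q (sumFin-term (λ c → ∥ palette y c ∥) c))))
    rank-step {x} {y} (x≼y , l) | no _ | no _
      with ℕₚ.m≤n⇒m<n∨m≡n (sumFin-mono (λ c → count-mono p (palette-mono {x} {y} x≼y c) zero))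
    ... | inj₁ less = inj₂ (ℕₚ.+-monoʳ-< threshold less)
    ... | inj₂ e = inj₁ (select-cong (λ c → ∥∥-squeeze (palette-mono {x} {y} x≼y c)
            (sumFin-squeeze (λ c → count-mono p (palette-mono {x} {y} x≼y c) zero) e c)))

    chain-Repeat : ∀ {k} x (xs : Vec (SignVector n) k) → Chain x xs →
      Repeat (map sgn (x ∷ xs)) ⊎ rank x + k ≤ threshold + suc t' * p'
    chain-Repeat x [] _ = inj₂ (subst (_≤ _) (sym (ℕₚ.+-identityʳ (rank x))) (rank-bound x))
    chain-Repeat x (y ∷ xs) (x⊏y , ch) with rank-step x⊏y | chain-Repeat y xs ch
    ... | inj₁ e | _ = inj₁ (subst (λ z → Repeat (sgn x ∷ z ∷ map sgn xs)) e Repeat.here)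
    ... | inj₂ _ | inj₁ rep = inj₁ (Repeat.there rep)
    ... | inj₂ less | inj₂ le = inj₂ (ℕₚ.≤-trans
            (ℕₚ.≤-trans (ℕₚ.≤-reflexive (ℕₚ.+-suc (rank x) _)) (ℕₚ.+-monoˡ-≤ _ less)) le)

  bound-suc : p * r + t' * p' ≡ suc (threshold + suc t' * p')
  bound-suc = begin
    p * suc r' + t' * p'
      ≡⟨ cong (_+ t' * p') (ℕₚ.*-suc p r') ⟩
    p + threshold + t' * p'
      ≡⟨ cong suc (trans (cong (_+ t' * p') (ℕₚ.+-comm p' threshold))
                         (ℕₚ.+-assoc threshold p' (t' * p'))) ⟩
    suc (threshold + (p' + t' * p')) ∎
    where open ≡-Reasoning

prime-matching : ∀ p' → Prime (suc p') → ∀ t' r' n (col : Subset n → Fin (suc t')) →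
  suc p' * suc r' + t' * p' ≤ n → ∃ (Matching col Full (suc r') (suc p'))
prime-matching p' p-prime t' r' n col le with PrimeMatching.full-class? p' p-prime t' r' col
... | yes h = PrimeMatching.full-class⇒Matching p' p-prime t' r' col h
... | no ¬h = ⊥-elim (absurd n col le ¬h)
  where
  absurd : ∀ n (col : Subset n → Fin (suc t')) → suc p' * suc r' + t' * p' ≤ n →
    ¬ PrimeMatching.Full-class p' p-prime t' r' col → ⊥
  absurd (suc n) col le ¬h = Tucker 1<p sgn (sgn-equivariant ¬h) rep
    where
    open PrimeMatching p' p-prime t' r' col
    open Means p' p-prime
    rep : ∀ (xs : Vec (SignVector (suc n)) (suc n)) → Chain 𝟎 xs → Repeat (map sgn xs)
    rep (x ∷ xs) ((_ , l) , ch) with chain-Repeat ¬h x xs ch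
    ... | inj₁ h = h
    ... | inj₂ b = contradiction (ℕₚ.≤-trans (ℕₚ.+-monoˡ-≤ n (rank-positive ¬h x (ℕₚ.≤-<-trans z≤n l))) b)
                     (ℕₚ.<⇒≱ (ℕₚ.≤-trans (ℕₚ.≤-reflexive (sym bound-suc)) le))

embed : ∀ {n} (W : Subset n) → Subset (card W) → Subset n
embed [] S = []
embed (outside ∷ W) S = outside ∷ embed W S
embed (inside ∷ W) (b ∷ S) = b ∷ embed W S

card-embed : ∀ {n} (W : Subset n) S → card (embed W S) ≡ card S
card-embed [] [] = refl
card-embed (outside ∷ W) S = card-embed W S
card-embed (inside ∷ W) (outside ∷ S) = card-embed W S
card-embed (inside ∷ W) (inside ∷ S) = cong suc (card-embed W S)

embed⊆ : ∀ {n} (W : Subset n) S → embed W S ⊆ W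
embed⊆ (outside ∷ W) S (there h) = there (embed⊆ W S h)
embed⊆ (inside ∷ W) (inside ∷ S) here = here
embed⊆ (inside ∷ W) (b ∷ S) (there h) = there (embed⊆ W S h)

embed-∈ : ∀ {n} (W : Subset n) S T {i} → i ∈ embed W S → i ∈ embed W T → ∃ λ j → j ∈ S × j ∈ T
embed-∈ (outside ∷ W) S T (there p) (there q) = embed-∈ W S T p q
embed-∈ (inside ∷ W) (inside ∷ S) (inside ∷ T) here here = zero , here , here
embed-∈ (inside ∷ W) (_ ∷ S) (_ ∷ T) (there p) (there q) with embed-∈ W S T p q
... | j , h , h' = suc j , there h , there h'

∩-Empty : ∀ {n} {S T : Subset n} → (∀ {i} → i ∈ S → i ∈ T → ⊥) → Empty (S ∩ T)
∩-Empty {S = S} {T} h (i , i∈) = h (proj₁ (Subsetₚ.x∈p∩q⁻ S T i∈)) (proj₂ (Subsetₚ.x∈p∩q⁻ S T i∈))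

Empty-∩ : ∀ {n} {S T : Subset n} → Empty (S ∩ T) → ∀ {i} → i ∈ S → i ∈ T → ⊥
Empty-∩ h p q = h (_ , Subsetₚ.x∈p∩q⁺ (p , q))

embed-Matching : ∀ {n t} {col : Subset n → Fin t} (W : Subset n) {r k c} →
  Matching (col ∘ embed W) Full r k c → Matching col W r k c
embed-Matching W M = record
  { sets = embed W ∘ sets
  ; within = λ i → embed⊆ W (sets i)
  ; size = λ i → trans (card-embed W (sets i)) (size i)
  ; coloured = coloured
  ; disjoint = λ i j i≢j → ∩-Empty (λ p q →
      let (_ , h , h') = embed-∈ W (sets i) (sets j) p q in Empty-∩ (disjoint i j i≢j) h h')
  }
  where open Matching M

widen : ∀ {n t} {col : Subset n → Fin t} {V W : Subset n} {r k c} → V ⊆ W →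
  Matching col V r k c → Matching col W r k c
widen V⊆W M = record { Matching M ; within = λ i → V⊆W ∘ Matching.within M i }

AlonFranklLovász : ℕ → Set
AlonFranklLovász k = ∀ t r {n} (col : Subset n → Fin (suc t)) (W : Subset n) →
  k * suc r + t * (k ∸ 1) ≤ card W → ∃ (Matching col W (suc r) k)

-- Colour the sets of size k₁ r + t (k₁ - 1) by the colour of a matching of size k₁ inside them.
AlonFranklLovász-* : ∀ k₁ k₂ → AlonFranklLovász (suc k₁) → AlonFranklLovász (suc k₂) →
  AlonFranklLovász (suc k₂ * suc k₁)
AlonFranklLovász-* k₁ k₂ afl₁ afl₂ t r {n} col W le
  with afl₂ t R col' W (subst (_≤ card W) (sym (identity (suc r) t k₁ k₂)) le)
  where
  R : ℕ
  R = r + k₁ * suc r + t * k₁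
  col' : Subset n → Fin (suc t)
  col' S with suc R ℕ.≤? card S
  ... | yes h = proj₁ (afl₁ t r col S h)
  ... | no _ = zero
  identity : ∀ r t k₁ k₂ →
    suc k₂ * (suc k₁ * r + t * k₁) + t * k₂ ≡ suc k₂ * suc k₁ * r + t * (k₁ + k₂ * suc k₁)
  identity = ℕ-solve-∀
... | c , M = c , record
  { sets = λ i → let (a , b) = split i in Matching.sets (inner a) b
  ; within = λ i → let (a , b) = split i in Matching.within M a ∘ Matching.within (inner a) b
  ; size = λ i → let (a , b) = split i in Matching.size (inner a) b
  ; coloured = λ i → let (a , b) = split i in Matching.coloured (inner a) b
  ; disjoint = λ i j i≢j → disjoint′ _ _ _ _ (λ e → i≢j (trans
      (sym (Finₚ.combine-remQuot {suc k₂} (suc k₁) i))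
      (trans (cong (λ { (a , b) → combine a b }) e) (Finₚ.combine-remQuot {suc k₂} (suc k₁) j))))
  }
  where
  split : Fin (suc k₂ * suc k₁) → Fin (suc k₂) × Fin (suc k₁)
  split = remQuot (suc k₁)
  inner : ∀ a → Matching col (Matching.sets M a) (suc r) (suc k₁) c
  inner a with suc (r + k₁ * suc r + t * k₁) ℕ.≤? card (Matching.sets M a) | Matching.coloured M a
  ... | yes h | e = subst (Matching col (Matching.sets M a) (suc r) (suc k₁)) e
                      (proj₂ (afl₁ t r col (Matching.sets M a) h))
  ... | no ¬h | _ = contradiction (ℕₚ.≤-reflexive (sym (Matching.size M a))) ¬h
  disjoint′ : ∀ a b a' b' → (a , b) ≢ (a' , b') →
    Empty (Matching.sets (inner a) b ∩ Matching.sets (inner a') b')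
  disjoint′ a b a' b' ≢ with a Finₚ.≟ a'
  ... | yes refl = Matching.disjoint (inner a) b b' (≢ ∘ cong (a ,_))
  ... | no a≢a' = ∩-Empty (λ p q → Empty-∩ (Matching.disjoint M a a' a≢a')
                    (Matching.within (inner a) b p) (Matching.within (inner a') b' q))

alonFranklLovász : ∀ k → 0 < k → AlonFranklLovász k
alonFranklLovász = <-rec (λ k → 0 < k → AlonFranklLovász k) step
  where
  one : AlonFranklLovász 1
  one t r col W le with subset-of-size (suc r) W
    (ℕₚ.≤-trans (ℕₚ.≤-reflexive (sym (ℕₚ.+-identityʳ (suc r)))) (ℕₚ.≤-trans (ℕₚ.m≤m+n _ (t * 0)) le))
  ... | S , S⊆W , e = col S , record
    { sets = λ _ → S ; within = λ _ → S⊆W ; size = λ _ → e ; coloured = λ _ → refl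
    ; disjoint = λ { zero zero 0≢0 → ⊥-elim (0≢0 refl) } }
  step : ∀ k → (∀ {j} → j < k → 0 < j → AlonFranklLovász j) → 0 < k → AlonFranklLovász k
  step 1 _ _ = one
  step k@(suc (suc k')) rec _ with composite? k
  ... | no ¬c = λ t r col W le →
    let (c , M) = prime-matching (suc k') (prime ¬c) t r (card W) (col ∘ embed W) le in c , embed-Matching W M
  ... | yes (composite {suc d} d<k (divides (suc q) e)) = subst AlonFranklLovász (sym e)
    (AlonFranklLovász-* d q (rec d<k ℕ.z<s) (rec q<k ℕ.z<s))
    where
    q<k : suc q < k
    q<k = subst (suc q <_) (sym e) (ℕₚ.m<m*n (suc q) (suc d) (ℕ.nonTrivial⇒n>1 (suc d)))
  ... | yes (composite {suc d} d<k (divides zero ()))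

card-─ : ∀ {n} (p q : Subset n) → card p ≤ card (p ─ q) + card q
card-─ [] [] = z≤n
card-─ (outside ∷ p) (outside ∷ q) = card-─ p q
card-─ (inside ∷ p) (outside ∷ q) = s≤s (card-─ p q)
card-─ (outside ∷ p) (inside ∷ q) =
  ℕₚ.≤-trans (card-─ p q) (ℕₚ.+-monoʳ-≤ (card (p ─ q)) (ℕₚ.n≤1+n (card q)))
card-─ (inside ∷ p) (inside ∷ q) =
  ℕₚ.≤-trans (s≤s (card-─ p q)) (ℕₚ.≤-reflexive (sym (ℕₚ.+-suc (card (p ─ q)) (card q))))

─-disjoint : ∀ {n} (p q : Subset n) {i} → i ∈ p ─ q → i ∈ q → ⊥
─-disjoint (_ ∷ p) (outside ∷ q) (there h) (there h') = ─-disjoint p q h h'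
─-disjoint (_ ∷ p) (inside ∷ q) (there h) (there h') = ─-disjoint p q h h'

-- Ramsey numbers of Kneser graphs

Matching-insert : ∀ {n t} {col : Subset n → Fin t} {W S : Subset n} {r k c} →
  S ⊆ W → card S ≡ r → col S ≡ c → Matching col (W ─ S) r k c → Matching col W r (suc k) c
Matching-insert {n} {col = col} {W} {S} {r} {k} {c} S⊆W e colS M = record
  { sets = sets′ ; within = within′ ; size = size′ ; coloured = coloured′ ; disjoint = disjoint′ }
  where
  open Matching M
  sets′ : Fin (suc k) → Subset n
  sets′ zero = S
  sets′ (suc i) = sets i
  within′ : ∀ i → sets′ i ⊆ W
  within′ zero = S⊆W
  within′ (suc i) = Subsetₚ.p─q⊆p W S ∘ within i
  size′ : ∀ i → card (sets′ i) ≡ r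
  size′ zero = e
  size′ (suc i) = size i
  coloured′ : ∀ i → col (sets′ i) ≡ c
  coloured′ zero = colS
  coloured′ (suc i) = coloured i
  disjoint′ : ∀ i j → i ≢ j → Empty (sets′ i ∩ sets′ j)
  disjoint′ zero zero ≢ = ⊥-elim (≢ refl)
  disjoint′ zero (suc j) _ = ∩-Empty (λ p q → ─-disjoint W S (within j q) p)
  disjoint′ (suc i) zero _ = ∩-Empty (λ p q → ─-disjoint W S (within i p) q)
  disjoint′ (suc i) (suc j) ≢ = disjoint i j (≢ ∘ cong suc)

asymmetric-matching : ∀ d m t r {n} (col : Subset n → Fin (suc t)) (W : Subset n) →
  (d + suc m) * suc r + t * m ≤ card W →
  Matching col W (suc r) (d + suc m) zero ⊎ ∃ λ c → Matching col W (suc r) (suc m) (suc c)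
asymmetric-matching zero m t r col W le with alonFranklLovász (suc m) ℕ.z<s t r col W le
... | zero , M = inj₁ M
... | suc c , M = inj₂ (c , M)
asymmetric-matching (suc d) m t r col W le
  with Subsetₚ.anySubset? (λ S → S Subsetₚ.⊆? W ×-dec (card S ℕ.≟ suc r ×-dec col S Finₚ.≟ zero))
... | yes (S , S⊆W , e , colS) = Sum.map (Matching-insert S⊆W e colS)
      (λ { (c , M) → c , widen (Subsetₚ.p─q⊆p W S) M })
      (asymmetric-matching d m t r col (W ─ S) (ℕₚ.+-cancelʳ-≤ (suc r) _ _ (begin
        (d + suc m) * suc r + t * m + suc r   ≡⟨ ring d (suc m) (suc r) (t * m) ⟩
        (suc d + suc m) * suc r + t * m       ≤⟨ le ⟩
        card W                                ≤⟨ card-─ W S ⟩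
        card (W ─ S) + card S                 ≡⟨ cong (card (W ─ S) +_) e ⟩
        card (W ─ S) + suc r                  ∎)))
  where
  open ℕₚ.≤-Reasoning
  ring : ∀ d m r x → (d + m) * r + x + r ≡ (suc d + m) * r + x
  ring = ℕ-solve-∀
... | no ¬h with alonFranklLovász (suc m) ℕ.z<s t r col W
        (ℕₚ.≤-trans (ℕₚ.+-monoˡ-≤ (t * m) (ℕₚ.*-monoˡ-≤ (suc r) (ℕₚ.m≤n+m (suc m) (suc d)))) le)
...   | suc c , M = inj₂ (c , M)
...   | zero , M = ⊥-elim (¬h (sets zero , within zero , size zero , coloured zero))
  where open Matching M

MonoClique-∷ : ∀ {V : Set} {Adj : V → V → Set} {c : Colouring V} {b a} →
  (∀ {u v} → Adj u v → Adj v u) → (K : MonoClique Adj c b a) (v : V) →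
  (∀ i → Adj v (proj₁ K i) × col c v (proj₁ K i) ≡ b) → MonoClique Adj c b (suc a)
MonoClique-∷ {V} {Adj} {c} {b} {a} sym-Adj (f , clique) v h = g , clique′
  where
  g : Fin (suc a) → V
  g zero = v
  g (suc i) = f i
  clique′ : ∀ i j → i ≢ j → Adj (g i) (g j) × col c (g i) (g j) ≡ b
  clique′ zero zero ≢ = ⊥-elim (≢ refl)
  clique′ zero (suc j) _ = h j
  clique′ (suc i) zero _ = sym-Adj (proj₁ (h i)) , trans (Colouring.sym c (f i) v) (proj₂ (h i))
  clique′ (suc i) (suc j) ≢ = clique i j (≢ ∘ cong suc)

MonoClique-tail : ∀ {V : Set} {Adj : V → V → Set} {c : Colouring V} {b a} →
  MonoClique Adj c b (suc a) → MonoClique Adj c b a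
MonoClique-tail (f , clique) = f ∘ suc , λ i j ≢ → clique (suc i) (suc j) (≢ ∘ Finₚ.suc-injective)

pullback : ∀ {U V : Set} → (U → V) → Colouring V → Colouring U
pullback F c = record { col = λ i j → col c (F i) (F j) ; sym = λ i j → Colouring.sym c (F i) (F j) }

swap-colours : ∀ {V : Set} → Colouring V → Colouring V
swap-colours c = record { col = λ u v → not (col c u v) ; sym = λ u v → cong not (Colouring.sym c u v) }

push-clique : ∀ {V : Set} {Adj : V → V → Set} {k} (F : Fin k → V) → (∀ i j → i ≢ j → Adj (F i) (F j)) →
  ∀ {c : Colouring V} {b a} (K : MonoClique (KAdj k) (pullback F c) b a) → MonoClique Adj c b a
push-clique F adj (g , clique) =
  F ∘ g , λ i j ≢ → adj (g i) (g j) (proj₁ (clique i j ≢)) , proj₂ (clique i j ≢)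

unswap : ∀ {V : Set} {Adj : V → V → Set} {c : Colouring V} {b a} →
  MonoClique Adj (swap-colours c) b a → MonoClique Adj c (not b) a
unswap {Adj = Adj} {c = c} (f , clique) = f , λ i j ≢ → proj₁ (clique i j ≢) ,
  trans (sym (Boolₚ.not-involutive (col c (f i) (f j)))) (cong not (proj₂ (clique i j ≢)))

module KneserUpper (u : ℕ) {n r′ : ℕ} (c : Colouring (KGVertex n (suc r′))) where

  private
    r = suc r′
    V = KGVertex n r
    Adj = KGAdj n r

  vertex-≡ : ∀ {S} (e e' : card S ≡ r) → _≡_ {A = V} (S , e) (S , e')
  vertex-≡ e e' = cong (_ ,_) (ℕₚ.≡-irrelevant e e')

  Adj-sym : ∀ {v w : V} → Adj v w → Adj w v
  Adj-sym h = ∩-Empty (λ p q → Empty-∩ h q p)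

  -- Junk value: false on sets that are not vertices.
  redTo : V → Subset n → Bool
  redTo v S with card S ℕ.≟ r
  ... | yes e = col c v (S , e)
  ... | no _ = false

  redTo-col : ∀ v S (e : card S ≡ r) → redTo v S ≡ col c v (S , e)
  redTo-col v S e with card S ℕ.≟ r
  ... | yes e' = cong (col c v) (vertex-≡ e' e)
  ... | no ¬e = contradiction e ¬e

  module _ {t k : ℕ} {κ : Subset n → Fin t} {W : Subset n} {i : Fin t} (M : Matching κ W r k i) where
    open Matching M

    vertices : Fin k → V
    vertices j = sets j , size j

    adjacent : ∀ v {b} → (∀ {x} → x ∈ proj₁ v → x ∈ W → ⊥) → (∀ j → redTo v (sets j) ≡ b) →
      ∀ j → Adj v (vertices j) × col c v (vertices j) ≡ b
    adjacent v avoids colours j = ∩-Empty (λ p q → avoids p (within j q)) ,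
      trans (sym (redTo-col v (sets j) (size j))) (colours j)

    push : ∀ {c′ : Colouring V} {b a} → MonoClique (KAdj k) (pullback vertices c′) b a → MonoClique Adj c′ b a
    push {c′} = push-clique {Adj = Adj} vertices disjoint {c′}

  Goal : Set
  Goal = MonoClique Adj c true (suc u) ⊎ MonoClique Adj c false (suc (suc u))

  extend : ∀ {c′ : Colouring V} {b a} (K : MonoClique Adj c′ b a) v →
    (∀ i → Adj v (proj₁ K i) × col c′ v (proj₁ K i) ≡ b) → MonoClique Adj c′ b (suc a)
  extend {c′} K v = MonoClique-∷ {Adj = Adj} {c = c′} (λ {x} {y} → Adj-sym {x} {y}) K v

  finish-red : ∀ {t k} {κ : Subset n → Fin t} {W i} → RamseyProp (Fin k) (KAdj k) u (suc (suc u)) →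
    (M : Matching κ W r k i) → ∀ v → (∀ {x} → x ∈ proj₁ v → x ∈ W → ⊥) →
    (∀ j → redTo v (Matching.sets M j) ≡ true) → Goal
  finish-red ramsey M v avoids reds with ramsey (pullback (vertices M) c)
  ... | inj₁ K = inj₁ (extend {c} (push M {c} K) v (λ i → adjacent M v avoids reds (proj₁ K i)))
  ... | inj₂ K = inj₂ (push M {c} K)

  finish-mixed : ∀ {t k} {κ : Subset n → Fin t} {W i} → RamseyProp (Fin k) (KAdj k) u (suc u) →
    (M : Matching κ W r k i) → ∀ v w →
    (∀ {x} → x ∈ proj₁ v → x ∈ W → ⊥) → (∀ {x} → x ∈ proj₁ w → x ∈ W → ⊥) →
    (∀ j → redTo v (Matching.sets M j) ≡ false) → (∀ j → redTo w (Matching.sets M j) ≡ true) → Goal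
  finish-mixed ramsey M v w avoids avoids′ blues reds with ramsey (pullback (vertices M) c)
  ... | inj₁ K = inj₁ (extend {c} (push M {c} K) w (λ i → adjacent M w avoids′ reds (proj₁ K i)))
  ... | inj₂ K = inj₂ (extend {c} (push M {c} K) v (λ i → adjacent M v avoids blues (proj₁ K i)))

  finish-blue : ∀ {t k} {κ : Subset n → Fin t} {W i} → RamseyProp (Fin k) (KAdj k) u (suc u) →
    (M : Matching κ W r k i) → ∀ v w → Adj v w → col c v w ≡ false →
    (∀ {x} → x ∈ proj₁ v → x ∈ W → ⊥) → (∀ {x} → x ∈ proj₁ w → x ∈ W → ⊥) →
    (∀ j → redTo v (Matching.sets M j) ≡ false) → (∀ j → redTo w (Matching.sets M j) ≡ false) → Goal
  finish-blue ramsey M v w vw blue avoids avoids′ blues blues′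
    with ramsey (pullback (vertices M) (swap-colours c))
  ... | inj₂ K = inj₁ (unswap {Adj = Adj} {c = c} (push M {swap-colours c} K))
  ... | inj₁ K = inj₂ (extend {c} K′ v λ { zero → vw , blue ; (suc i) → adjacent M v avoids blues (proj₁ K i) })
    where
    K′ = extend {c} (unswap {Adj = Adj} {c = c} (push M {swap-colours c} K)) w
           (λ i → adjacent M w avoids′ blues′ (proj₁ K i))

  module _ {d m : ℕ} (ramsey₁ : RamseyProp (Fin (d + suc m)) (KAdj (d + suc m)) u (suc (suc u)))
           (ramsey₂ : RamseyProp (Fin (suc m)) (KAdj (suc m)) u (suc u))
           (large : (d + suc m) * r + 2 * m + (r + r) ≤ n) where

    base : ∃ λ S → S ⊆ Full × card S ≡ r
    base = subset-of-size r (Full {n}) (ℕₚ.≤-trans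
      (ℕₚ.≤-trans (ℕₚ.m≤m+n r r) (ℕₚ.≤-trans (ℕₚ.m≤n+m (r + r) _) large))
      (ℕₚ.≤-reflexive (sym (Subsetₚ.∣⊤∣≡n n))))

    A : Subset n
    A = proj₁ base

    v : V
    v = A , proj₂ (proj₂ base)

    U : Subset n
    U = Full ─ A

    card-U : n ≤ card U + r
    card-U = subst₂ (λ x y → x ≤ card U + y) (Subsetₚ.∣⊤∣≡n n) (proj₂ (proj₂ base)) (card-─ Full A)

    avoids-A : ∀ {x} → x ∈ A → x ∈ U → ⊥
    avoids-A p q = ─-disjoint Full A q p

    large-U : (d + suc m) * r + 2 * m + r ≤ card U
    large-U = ℕₚ.+-cancelʳ-≤ r _ _ (ℕₚ.≤-trans (ℕₚ.≤-reflexive (ℕₚ.+-assoc _ r r)) (ℕₚ.≤-trans large card-U))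

    conclusion : Goal
    conclusion with Subsetₚ.anySubset? (λ S → S Subsetₚ.⊆? U ×-dec (card S ℕ.≟ r ×-dec redTo v S Boolₚ.≟ false))
    ... | no ¬blue = finish-red ramsey₁ M v avoids-A (λ j → Boolₚ.¬-not (λ blue →
            ¬blue (Matching.sets M j , Matching.within M j , Matching.size M j , blue)))
      where
      trivial : ∃ (Matching {t = 1} (λ _ → zero) U r (d + suc m))
      trivial = alonFranklLovász (d + suc m) (ℕₚ.<-≤-trans ℕ.z<s (ℕₚ.m≤n+m (suc m) d)) 0 r′ (λ _ → zero) U
        (ℕₚ.≤-trans (ℕₚ.+-monoʳ-≤ ((d + suc m) * r) z≤n) (ℕₚ.≤-trans (ℕₚ.m≤m+n _ r) large-U))
      M = proj₂ trivial
    ... | yes (B , B⊆U , e , blue) = by-type (asymmetric-matching d m 2 r′ κ W large-W)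
      where
      w : V
      w = B , e
      W : Subset n
      W = U ─ B
      large-W : (d + suc m) * r + 2 * m ≤ card W
      large-W = ℕₚ.+-cancelʳ-≤ r _ _ (ℕₚ.≤-trans large-U (subst (λ x → card U ≤ card W + x) e (card-─ U B)))
      κ : Subset n → Fin 3
      κ S = if redTo v S then zero else if redTo w S then suc zero else suc (suc zero)
      red : ∀ S → κ S ≡ zero → redTo v S ≡ true
      red S h with redTo v S | redTo w S
      ... | true | _ = refl
      red S () | false | true
      red S () | false | false
      mixed : ∀ S → κ S ≡ suc zero → redTo v S ≡ false × redTo w S ≡ true
      mixed S h with redTo v S | redTo w S
      ... | false | true = refl , refl
      bluish : ∀ S → κ S ≡ suc (suc zero) → redTo v S ≡ false × redTo w S ≡ false
      bluish S h with redTo v S | redTo w S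
      ... | false | false = refl , refl
      avoids-v : ∀ {x} → x ∈ A → x ∈ W → ⊥
      avoids-v p q = avoids-A p (Subsetₚ.p─q⊆p U B q)
      avoids-w : ∀ {x} → x ∈ B → x ∈ W → ⊥
      avoids-w p q = ─-disjoint U B q p
      by-type : Matching κ W r (d + suc m) zero ⊎ ∃ (λ i → Matching κ W r (suc m) (suc i)) → Goal
      by-type (inj₁ M) = finish-red ramsey₁ M v avoids-v (λ j → red (Matching.sets M j) (Matching.coloured M j))
      by-type (inj₂ (zero , M)) = finish-mixed ramsey₂ M v w avoids-v avoids-w
        (λ j → proj₁ (mixed (Matching.sets M j) (Matching.coloured M j)))
        (λ j → proj₂ (mixed (Matching.sets M j) (Matching.coloured M j)))
      by-type (inj₂ (suc zero , M)) = finish-blue ramsey₂ M v w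
        (∩-Empty (λ p q → avoids-A p (B⊆U q))) (trans (sym (redTo-col v B e)) blue) avoids-v avoids-w
        (λ j → proj₁ (bluish (Matching.sets M j) (Matching.coloured M j)))
        (λ j → proj₂ (bluish (Matching.sets M j) (Matching.coloured M j)))

toBool : Fin 2 → Bool
toBool zero = false
toBool (suc _) = true

fromBool : Bool → Fin 2
fromBool b = if b then suc zero else zero

toBool-fromBool : ∀ b → toBool (fromBool b) ≡ b
toBool-fromBool true = refl
toBool-fromBool false = refl

MonoClique-resp : ∀ {V : Set} {Adj : V → V → Set} {c c' : Colouring V} {b a} →
  (∀ u v → col c u v ≡ col c' u v) → MonoClique Adj c b a → MonoClique Adj c' b a
MonoClique-resp e (f , clique) =
  f , λ i j ≢ → proj₁ (clique i j ≢) , trans (sym (e (f i) (f j))) (proj₂ (clique i j ≢))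

record Enumeration (V : Set) : Set where
  field
    N : ℕ
    enum : Fin N → V
    index : V → Fin N
    enum-index : ∀ v → enum (index v) ≡ v

module FiniteRamsey {V : Set} (E : Enumeration V) {Adj : V → V → Set}
                    (Adj? : ∀ u v → Dec (Adj u v)) where

  open Enumeration E

  monoClique? : ∀ c b a → Dec (MonoClique Adj c b a)
  monoClique? c b a = map′ (λ { (k , h) → enum ∘ finToFun k , h }) code
    (Finₚ.any? (λ k → isClique? (enum ∘ finToFun k)))
    where
    IsClique : (Fin a → V) → Set
    IsClique f = ∀ i j → i ≢ j → Adj (f i) (f j) × col c (f i) (f j) ≡ b
    isClique? : ∀ f → Dec (IsClique f)
    isClique? f = Finₚ.all? (λ i → Finₚ.all? (λ j →
      ¬? (i Finₚ.≟ j) →-dec (Adj? (f i) (f j) ×-dec col c (f i) (f j) Boolₚ.≟ b)))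
    code : MonoClique Adj c b a → ∃ λ (k : Fin (N ^ a)) → IsClique (enum ∘ finToFun k)
    code (f , clique) = funToFin (index ∘ f) , λ i j ≢ →
      subst₂ (λ u v → Adj u v × col c u v ≡ b) (sym (decode i)) (sym (decode j)) (clique i j ≢)
      where
      decode : ∀ i → enum (finToFun (funToFin (index ∘ f)) i) ≡ f i
      decode i = trans (cong enum (Finₚ.finToFun-funToFin (index ∘ f) i)) (enum-index (f i))

  entry : Fin (2 ^ (N * N)) → V → V → Bool
  entry k u v = toBool (finToFun k (combine (index u) (index v)))

  tabled : Fin (2 ^ (N * N)) → Colouring V
  tabled k = record { col = col′ ; sym = sym′ }
    where
    col′ : V → V → Bool
    col′ u v with toℕ (index u) ℕ.≤? toℕ (index v)
    ... | yes _ = entry k u v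
    ... | no _ = entry k v u
    sym′ : ∀ u v → col′ u v ≡ col′ v u
    sym′ u v with toℕ (index u) ℕ.≤? toℕ (index v) | toℕ (index v) ℕ.≤? toℕ (index u)
    ... | yes _ | no _ = refl
    ... | no _ | yes _ = refl
    ... | yes l | yes l' = cong₂ (λ i j → toBool (finToFun k (combine i j))) e (sym e)
      where e = Finₚ.toℕ-injective (ℕₚ.≤-antisym l l')
    ... | no ¬l | no ¬l' = contradiction (ℕₚ.<⇒≤ (ℕₚ.≰⇒> ¬l)) ¬l'

  tabled-surjective : ∀ c → ∃ λ k → ∀ u v → col (tabled k) u v ≡ col c u v
  tabled-surjective c = k , agree
    where
    table : Fin N × Fin N → Fin 2
    table (i , j) = fromBool (col c (enum i) (enum j))
    k = funToFin (table ∘ remQuot N)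
    entry-k : ∀ u v → entry k u v ≡ col c u v
    entry-k u v = begin
      toBool (finToFun k (combine (index u) (index v)))
        ≡⟨ cong toBool (Finₚ.finToFun-funToFin (table ∘ remQuot N) (combine (index u) (index v))) ⟩
      toBool (table (remQuot N (combine (index u) (index v))))
        ≡⟨ cong (toBool ∘ table) (Finₚ.remQuot-combine (index u) (index v)) ⟩
      toBool (table (index u , index v))
        ≡⟨ toBool-fromBool _ ⟩
      col c (enum (index u)) (enum (index v))
        ≡⟨ cong₂ (col c) (enum-index u) (enum-index v) ⟩
      col c u v ∎
      where open ≡-Reasoning
    agree : ∀ u v → col (tabled k) u v ≡ col c u v
    agree u v with toℕ (index u) ℕ.≤? toℕ (index v)
    ... | yes _ = entry-k u v
    ... | no _ = trans (entry-k v u) (Colouring.sym c v u)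

  ramseyProp? : ∀ a b → Dec (RamseyProp V Adj a b)
  ramseyProp? a b = map′
    (λ h c → let (k , e) = tabled-surjective c in
      Sum.map (MonoClique-resp {Adj = Adj} {tabled k} {c} e) (MonoClique-resp {Adj = Adj} {tabled k} {c} e) (h k))
    (λ h k → h (tabled k))
    (Finₚ.all? (λ k → monoClique? (tabled k) true a ⊎-dec monoClique? (tabled k) false b))

kneser-enumeration : ∀ n r → Enumeration (KGVertex n r)
kneser-enumeration n r with Subsetₚ.anySubset? (λ S → card {n} S ℕ.≟ r)
... | no ¬v = record { N = 0 ; enum = λ () ; index = ⊥-elim ∘ ¬v ; enum-index = ⊥-elim ∘ ¬v }
... | yes v = record { N = 2 ^ n ; enum = vertex ∘ decode ; index = code ∘ proj₁ ; enum-index = vertex-code }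
  where
  decode : Fin (2 ^ n) → Subset n
  decode k = tabulate (toBool ∘ finToFun k)
  code : Subset n → Fin (2 ^ n)
  code S = funToFin (fromBool ∘ lookup S)
  decode-code : ∀ S → decode (code S) ≡ S
  decode-code S = trans
    (Vecₚ.tabulate-cong (λ i → trans
      (cong toBool (Finₚ.finToFun-funToFin (fromBool ∘ lookup S) i)) (toBool-fromBool (lookup S i))))
    (Vecₚ.tabulate∘lookup S)
  vertex : Subset n → KGVertex n r
  vertex S with card S ℕ.≟ r
  ... | yes e = S , e
  ... | no _ = v
  vertex-≡ : ∀ S (e : card S ≡ r) → vertex S ≡ (S , e)
  vertex-≡ S e with card S ℕ.≟ r
  ... | yes e' = cong (S ,_) (ℕₚ.≡-irrelevant e' e)
  ... | no ¬e = contradiction e ¬e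
  vertex-code : ∀ w → vertex (decode (code (proj₁ w))) ≡ w
  vertex-code (S , e) = trans (cong vertex (decode-code S)) (vertex-≡ S e)

kneser-adjacent? : ∀ n r (u v : KGVertex n r) → Dec (KGAdj n r u v)
kneser-adjacent? n r (S , _) (T , _) = ¬? (Subsetₚ.nonempty? (S ∩ T))

least : ∀ {P : ℕ → Set} → (∀ n → Dec (P n)) → ∀ N → P N → ∃ λ m → IsLeast P m × m ≤ N
least {P} P? N PN with search (suc N)
  where
  search : ∀ k → (∃ λ m → IsLeast P m × m < k) ⊎ (∀ j → j < k → ¬ P j)
  search zero = inj₂ (λ _ ())
  search (suc k) with search k
  ... | inj₁ (m , least-m , m<k) = inj₁ (m , least-m , ℕₚ.m<n⇒m<1+n m<k)
  ... | inj₂ none with P? k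
  ...   | yes Pk = inj₁ (k , (Pk , none) , ℕₚ.n<1+n k)
  ...   | no ¬Pk = inj₂ (λ j j<1+k → case (ℕₚ.m≤n⇒m<n∨m≡n (ℕₚ.≤-pred j<1+k)))
    where
    case : ∀ {j} → j < k ⊎ j ≡ k → ¬ P j
    case (inj₁ j<k) = none _ j<k
    case (inj₂ refl) = ¬Pk
... | inj₁ (m , least-m , m<1+N) = m , least-m , ℕₚ.≤-pred m<1+N
... | inj₂ none = contradiction PN (none N (ℕₚ.n<1+n N))

RamseyProp-0 : ∀ {V : Set} {Adj : V → V → Set} {a b} → ¬ V → ¬ RamseyProp V Adj (suc a) (suc b)
RamseyProp-0 ¬V ramsey with ramsey (record { col = λ _ _ → true ; sym = λ _ _ → refl })
... | inj₁ (f , _) = ¬V (f zero)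
... | inj₂ (f , _) = ¬V (f zero)

RamseyProp-tail : ∀ {V : Set} {Adj : V → V → Set} {a b} → RamseyProp V Adj a (suc b) → RamseyProp V Adj a b
RamseyProp-tail {Adj = Adj} ramsey c = Sum.map id (MonoClique-tail {Adj = Adj} {c}) (ramsey c)

theorem1p8 : (s r : ℕ) → 4 ≤ s → 1 ≤ r →
    (R₁ R₂ : ℕ) → IsRamseyNumber (s ∸ 2) s R₁ → IsRamseyNumber (s ∸ 2) (s ∸ 1) R₂ →
    Σ ℕ λ m → IsKneserRamseyNumber r (s ∸ 1) s m × m ≤ r * R₁ + 2 * (R₂ ∸ 1) + 2 * r
theorem1p8 (suc (suc (suc (suc s)))) (suc r) (s≤s (s≤s (s≤s (s≤s _)))) (s≤s _) R₁ zero _ (ramsey₂ , _) =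
  ⊥-elim (RamseyProp-0 {Adj = KAdj 0} (λ ()) ramsey₂)
theorem1p8 (suc (suc (suc (suc s)))) (suc r) (s≤s (s≤s (s≤s (s≤s _)))) (s≤s _) R₁ (suc m)
  (ramsey₁ , _) (ramsey₂ , least₂) =
  least (λ n → FiniteRamsey.ramseyProp? (kneser-enumeration n (suc r)) (kneser-adjacent? n (suc r))
                 (suc u) (suc (suc u)))
    (suc r * R₁ + 2 * m + 2 * suc r)
    (λ c → KneserUpper.conclusion u c {R₁ ∸ suc m}
      (subst (λ k → RamseyProp (Fin k) (KAdj k) u (suc (suc u))) (sym R₁-split) ramsey₁) ramsey₂
      (ℕₚ.≤-reflexive (cong₂ (λ x y → x + 2 * m + y)
        (trans (cong (_* suc r) R₁-split) (ℕₚ.*-comm R₁ (suc r)))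
        (cong (suc r +_) (sym (ℕₚ.+-identityʳ (suc r)))))))
  where
  u = suc (suc s)
  R₂≤R₁ : suc m ≤ R₁
  R₂≤R₁ with ℕₚ.<-≤-connex R₁ (suc m)
  ... | inj₂ le = le
  ... | inj₁ lt = ⊥-elim (least₂ R₁ lt (RamseyProp-tail {Adj = KAdj R₁} ramsey₁))
  R₁-split : R₁ ∸ suc m + suc m ≡ R₁
  R₁-split = ℕₚ.m∸n+n≡m R₂≤R₁
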